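{- For every odd prime $p>2$, \[ \sum_{n=0}^{p-1}\frac{(\frac{1}{2})_n(\frac{1}{3})_n(\frac{1}{4})_n(\frac{3}{4})_n}{(1)_n^5}(-1)^n\left(172n^2+75n+9\right)\left(\frac{27}{16}\right)^n\equiv 9p^2 \pmod{p^5}. \] Equivalently, $\sum_{n=0}^{p-1}\frac{(-1)^n(172n^2+75n+9)}{2^{12n}}\binom{2n}{n}^3\binom{3n}{n}\binom{4n}{2n}\equiv 9p^2 \pmod{p^5}$.
   Context: $(a)_n=\prod_{k=0}^{n-1}(a+k)$ denotes the Pochhammer symbol (rising factorial), with $(a)_0=1$. Congruences between rational numbers whose denominators are coprime to $p$ are understood in the ring of $p$-integral rationals.
   Formalization: The first sum is stated with the additional factor (2/3)_n in the numerator, missing in the display above; without it the congruence fails (e.g. at p = 3) and the two forms are not equivalent. The binomial form is as given. -}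

module Defs where

open import Data.Nat as ℕ using (ℕ; zero; suc)
import Data.Nat.Properties as ℕ
open import Data.Nat.Coprimality using (Coprime)
open import Data.Nat.Combinatorics using (_C_)
open import Data.Integer as ℤ using (ℤ; +_; -1ℤ)
open import Data.Rational using (ℚ; 0ℚ; 1ℚ; -_; _+_; _-_; _*_; _÷_; _/_; ½; ↧ₙ_; Positive; NonZero; +-*-rawSemiring)
open import Data.Rational.Properties using (pos⇒nonZero; pos*pos⇒pos; pos+nonNeg⇒pos; normalize-nonNeg)
open import Algebra.Definitions.RawSemiring +-*-rawSemiring using (_^_)
open import Data.Product using (_×_; ∃-syntax)
open import Relation.Binary.PropositionalEquality using (_≡_)

fromℕ : ℕ → ℚ
fromℕ n = + n / 1

-- ∑< n f = f 0 + f 1 + ⋯ + f (n - 1)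
∑< : ℕ → (ℕ → ℚ) → ℚ
∑< zero    f = 0ℚ
∑< (suc n) f = ∑< n f + f n

-- ⟨ a ⟩ n is the Pochhammer symbol (a)ₙ = a (a + 1) ⋯ (a + n - 1).
⟨_⟩_ : ℚ → ℕ → ℚ
⟨ a ⟩ zero  = 1ℚ
⟨ a ⟩ suc n = ⟨ a ⟩ n * (a + fromℕ n)

infix 9 ⟨_⟩_

⟨⟩-pos : ∀ a .{{_ : Positive a}} n → Positive (⟨ a ⟩ n)
⟨⟩-pos a zero    = _
⟨⟩-pos a (suc n) = pos*pos⇒pos (⟨ a ⟩ n) {{⟨⟩-pos a n}} (a + fromℕ n) {{pos+nonNeg⇒pos a (fromℕ n) {{normalize-nonNeg n 1}}}}

^-pos : ∀ x .{{_ : Positive x}} n → Positive (x ^ n)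
^-pos x zero    = _
^-pos x (suc n) = pos*pos⇒pos x (x ^ n) {{^-pos x n}}

⟨1⟩^5≢0 : ∀ n → NonZero ((⟨ 1ℚ ⟩ n) ^ 5)
⟨1⟩^5≢0 n = pos⇒nonZero ((⟨ 1ℚ ⟩ n) ^ 5) {{^-pos (⟨ 1ℚ ⟩ n) {{⟨⟩-pos 1ℚ n}} 5}}

quad : ℕ → ℕ
quad n = 172 ℕ.* n ℕ.^ 2 ℕ.+ 75 ℕ.* n ℕ.+ 9

-- The factor (2/3)ₙ is needed for this summand to equal binomialTerm n;
-- without it the congruence already fails at p = 3.
pochhammerTerm : ℕ → ℚ
pochhammerTerm n =
  _÷_ (⟨ ½ ⟩ n * ⟨ + 1 / 3 ⟩ n * ⟨ + 2 / 3 ⟩ n * ⟨ + 1 / 4 ⟩ n * ⟨ + 3 / 4 ⟩ n)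
      ((⟨ 1ℚ ⟩ n) ^ 5) {{⟨1⟩^5≢0 n}}
    * (- 1ℚ) ^ n * fromℕ (quad n) * (+ 27 / 16) ^ n

binomialTerm : ℕ → ℚ
binomialTerm n =
  _/_ (-1ℤ ℤ.^ n ℤ.* + quad n) (2 ℕ.^ (12 ℕ.* n)) {{ℕ.m^n≢0 2 (12 ℕ.* n)}}
    * fromℕ (((2 ℕ.* n) C n) ℕ.^ 3 ℕ.* ((3 ℕ.* n) C n) ℕ.* ((4 ℕ.* n) C (2 ℕ.* n)))

-- ↧ₙ is the denominator in lowest terms.
Integral : ℕ → ℚ → Set
Integral p x = Coprime (↧ₙ x) p

-- Congruence modulo the ideal generated by m in the ring of p-integral rationals.
infix 4 _≡_[mod_]⟨_⟩

_≡_[mod_]⟨_⟩ : ℚ → ℚ → ℕ → ℕ → Set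
x ≡ y [mod m ]⟨ p ⟩ =
  Integral p x × Integral p y × ∃[ z ] (Integral p z × x - y ≡ fromℕ m * z)

{-# OPTIONS --safe #-}
-- Let y be a formal parameter, z = 2y, and consider the deformed summand
--   G(n, z) = (-1)ⁿ (y)ₙ³ (y)₂ₙ (1 - y)ₙ (3n)! / (n!³ (2n)!³) · Q(n, z) / (2n + 1)³,
-- where Q(n, z) is a polynomial with Q(n, 1) = (2n + 1)³ (172n² + 75n + 9); at z = 1 it is the
-- summand of the theorem.  It is half of a Wilf–Zeilberger pair
--   G(n, z + 2) - G(n, z) = F(n + 1, z) - F(n, z)   with   F(0, z) = 0,
-- which specialises Dougall's ₅H₅ sum.  Hence S(z) = ∑_{n<p} G(n, z) satisfies
-- S(z + 2) - S(z) = F(p, z), and S(0) = 0 because G(n, 0) = 0 for all n.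
-- As a function on p-adic integers S is continuous, so S(1) is read off from S(1 - p⁸), and
-- 1 - p⁸ is reached from 0 by steps of -2.  Along the way F(p, -2j) ≡ 0 (mod p⁵) unless
-- j = p i, and there Wolstenholme's congruence ∏_{0<j<p} (j + p x) ≡ (p - 1)! (mod p³) gives
-- F(p, -2pi) ≡ 96 p² i (i - 1) (2i - 1).  Summing over i up to (p⁷ - 1)/2, that is up to -1/2
-- p-adically, yields 9 p².  The prime 3, where Wolstenholme's congruence fails, is checked directly.
-- Denominators are cleared throughout: the sums are multiplied by 64ʳ r!³ (2r + 1)!³ with
-- r = p - 1, which has p-adic valuation 3, so all congruences are between integers modulo p⁸.
module Submission where

open import Algebra.Bundles using (CommutativeMonoid)
open import Data.Nat as ℕ using (ℕ; zero; suc)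

-- Finite products in a commutative monoid.

module FiniteProduct {c ℓ} (M : CommutativeMonoid c ℓ) where
  open CommutativeMonoid M
  open import Relation.Binary.Reasoning.Setoid setoid
  open import Algebra.Properties.CommutativeSemigroup commutativeSemigroup using (interchange)
  import Data.Nat.Properties as ℕ

  ∏ : ℕ → (ℕ → Carrier) → Carrier
  ∏ zero    f = ε
  ∏ (suc n) f = ∏ n f ∙ f n

  ∏-cong : ∀ n {f g} → (∀ i → i ℕ.< n → f i ≈ g i) → ∏ n f ≈ ∏ n g
  ∏-cong zero    f≈g = refl
  ∏-cong (suc n) f≈g = ∙-cong (∏-cong n λ i i<n → f≈g i (ℕ.m<n⇒m<1+n i<n)) (f≈g n (ℕ.n<1+n n))

  ∏-∙ : ∀ n f g → ∏ n (λ i → f i ∙ g i) ≈ ∏ n f ∙ ∏ n g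
  ∏-∙ zero    f g = sym (identityˡ ε)
  ∏-∙ (suc n) f g = trans (∙-congʳ (∏-∙ n f g)) (interchange _ _ _ _)

  ∏-+ : ∀ m n f → ∏ (m ℕ.+ n) f ≈ ∏ m f ∙ ∏ n (λ i → f (m ℕ.+ i))
  ∏-+ m zero    f rewrite ℕ.+-identityʳ m = sym (identityʳ _)
  ∏-+ m (suc n) f rewrite ℕ.+-suc m n = trans (∙-congʳ (∏-+ m n f)) (assoc _ _ _)

  ∏-head : ∀ n f → ∏ (suc n) f ≈ f 0 ∙ ∏ n (λ i → f (suc i))
  ∏-head n f = trans (∏-+ 1 n f) (∙-congʳ (identityˡ _))

  ∏-interleave : ∀ n f → ∏ (n ℕ.+ n) f ≈ ∏ n (λ i → f (i ℕ.+ i)) ∙ ∏ n (λ i → f (suc (i ℕ.+ i)))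
  ∏-interleave zero    f = sym (identityˡ ε)
  ∏-interleave (suc n) f rewrite ℕ.+-suc n n = begin
    ∏ (n ℕ.+ n) f ∙ f (n ℕ.+ n) ∙ f (suc (n ℕ.+ n))     ≈⟨ assoc _ _ _ ⟩
    ∏ (n ℕ.+ n) f ∙ (f (n ℕ.+ n) ∙ f (suc (n ℕ.+ n)))   ≈⟨ ∙-congʳ (∏-interleave n f) ⟩
    _                                                   ≈⟨ interchange _ _ _ _ ⟩
    _ ∎

  ∏-reverse : ∀ n f → ∏ n (λ i → f (n ℕ.∸ suc i)) ≈ ∏ n f
  ∏-reverse zero    f = refl
  ∏-reverse (suc n) f = begin
    ∏ (suc n) (λ i → f (n ℕ.∸ i))          ≈⟨ ∏-head n (λ i → f (n ℕ.∸ i)) ⟩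
    f n ∙ ∏ n (λ i → f (n ℕ.∸ suc i))      ≈⟨ ∙-congˡ (∏-reverse n f) ⟩
    f n ∙ ∏ n f                            ≈⟨ comm _ _ ⟩
    ∏ n f ∙ f n                            ∎

-- Congruences between integers.

module Congruence where
  open import Data.Integer hiding (suc)
  open import Data.Integer.Properties
  open import Data.Integer.Tactic.RingSolver
  open import Relation.Binary.PropositionalEquality
  open import Relation.Nullary using (yes; no)
  import Data.Nat.Properties as ℕ
  open FiniteProduct *-1-commutativeMonoid using (∏)

  infix 4 _≅_mod_
  -- The modulus is an arbitrary integer, since moduli such as `X * X * X` with `X` negative or zero
  -- occur below. The explicit quotient lets most rules be proved as ring identities.
  record _≅_mod_ (a b m : ℤ) : Set where
    constructor modulo
    field
      quotient : ℤ
      equality : a ≡ b + m * quotient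

  ≡⇒≅ : ∀ {a b m} → a ≡ b → a ≅ b mod m
  ≡⇒≅ {a} {m = m} refl = modulo 0ℤ (lemma a m)
    where
    lemma : ∀ a m → a ≡ a + m * 0ℤ
    lemma = solve-∀

  ≅-refl : ∀ {a m} → a ≅ a mod m
  ≅-refl = ≡⇒≅ refl

  ≅-sym : ∀ {a b m} → a ≅ b mod m → b ≅ a mod m
  ≅-sym {b = b} {m} (modulo k refl) = modulo (- k) (lemma b m k)
    where
    lemma : ∀ b m k → b ≡ b + m * k + m * (- k)
    lemma = solve-∀

  ≅-trans : ∀ {a b c m} → a ≅ b mod m → b ≅ c mod m → a ≅ c mod m
  ≅-trans {c = c} {m} (modulo k refl) (modulo l refl) = modulo (l + k) (lemma c m k l)
    where
    lemma : ∀ c m k l → c + m * l + m * k ≡ c + m * (l + k)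
    lemma = solve-∀

  ≅-+ : ∀ {a b c d m} → a ≅ b mod m → c ≅ d mod m → a + c ≅ b + d mod m
  ≅-+ {b = b} {d = d} {m} (modulo k refl) (modulo l refl) = modulo (k + l) (lemma b d m k l)
    where
    lemma : ∀ b d m k l → b + m * k + (d + m * l) ≡ b + d + m * (k + l)
    lemma = solve-∀

  ≅-neg : ∀ {a b m} → a ≅ b mod m → - a ≅ - b mod m
  ≅-neg {b = b} {m} (modulo k refl) = modulo (- k) (lemma b m k)
    where
    lemma : ∀ b m k → - (b + m * k) ≡ - b + m * (- k)
    lemma = solve-∀

  ≅-* : ∀ {a b c d m} → a ≅ b mod m → c ≅ d mod m → a * c ≅ b * d mod m
  ≅-* {b = b} {d = d} {m} (modulo k refl) (modulo l refl) = modulo _ (lemma b d m k l)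
    where
    lemma : ∀ b d m k l → (b + m * k) * (d + m * l) ≡ b * d + m * (b * l + k * d + m * (k * l))
    lemma = solve-∀

  -- Used with `c = p⁵` to lift a congruence modulo `p³` to one modulo `p⁸`.
  ≅-scale : ∀ {a b m} c → a ≅ b mod m → c * a ≅ c * b mod (c * m)
  ≅-scale {b = b} {m} c (modulo k refl) = modulo k (lemma b m c k)
    where
    lemma : ∀ b m c k → c * (b + m * k) ≡ c * b + c * m * k
    lemma = solve-∀

  ≅-∏ : ∀ {m} n {f g} → (∀ i → f i ≅ g i mod m) → ∏ n f ≅ ∏ n g mod m
  ≅-∏ zero    f≅g = ≅-refl
  ≅-∏ (suc n) f≅g = ≅-* (≅-∏ n f≅g) (f≅g n)

  -- The moduli multiply, so the powers of `p` contributed by different factors add up.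
  0≅-* : ∀ {a b m n} → a ≅ 0ℤ mod m → b ≅ 0ℤ mod n → a * b ≅ 0ℤ mod (m * n)
  0≅-* {m = m} {n} (modulo k refl) (modulo l refl) = modulo (k * l) (lemma m n k l)
    where
    lemma : ∀ m n k l → (0ℤ + m * k) * (0ℤ + n * l) ≡ 0ℤ + m * n * (k * l)
    lemma = solve-∀

  ≅0-*ˡ : ∀ {b m} a → b ≅ 0ℤ mod m → a * b ≅ 0ℤ mod m
  ≅0-*ˡ {m = m} a (modulo k refl) = modulo (a * k) (lemma a m k)
    where
    lemma : ∀ a m k → a * (0ℤ + m * k) ≡ 0ℤ + m * (a * k)
    lemma = solve-∀

  ≅0-*ʳ : ∀ {a m} b → a ≅ 0ℤ mod m → a * b ≅ 0ℤ mod m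
  ≅0-*ʳ {a} {m} b a≅0 = subst (_≅ 0ℤ mod m) (*-comm b a) (≅0-*ˡ b a≅0)

  ∏≅0 : ∀ {m} n f i → i ℕ.< n → f i ≅ 0ℤ mod m → ∏ n f ≅ 0ℤ mod m
  ∏≅0 (suc n) f i i<1+n fi≅0 with i ℕ.≟ n
  ... | yes refl = ≅0-*ˡ (∏ n f) fi≅0
  ... | no  i≢n  = ≅0-*ʳ (f n) (∏≅0 n f i (ℕ.≤∧≢⇒< (ℕ.s≤s⁻¹ i<1+n) i≢n) fi≅0)

-- The Wilf-Zeilberger pair with cleared denominators.

module WilfZeilberger where
  open import Data.Integer hiding (suc)
  open import Data.Integer.Properties
  open import Data.Integer.Tactic.RingSolver
  open import Relation.Binary.PropositionalEquality
  import Data.Nat.Properties as ℕ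
  open FiniteProduct *-1-commutativeMonoid
  open ≡-Reasoning

  -- With z = 2y these are 2ⁿ (y)ₙ and (-2)ⁿ (1 - y)ₙ.
  rise fall : ℤ → ℕ → ℤ
  rise z n = ∏ n λ i → z + + 2 * + i
  fall z n = ∏ n λ i → z - + 2 * + suc i

  factorial : ℕ → ℤ
  factorial n = ∏ n λ i → + suc i

  -- With `z = 2y` this is `(-64)ⁿ (y)ₙ³ (y)₂ₙ (1 - y)ₙ (3n)!`: the factors contribute the powers
  -- `2³ⁿ`, `2²ⁿ` and `(-2)ⁿ`.
  kernel : ℕ → ℤ → ℤ
  kernel n z = rise z n * rise z n * rise z n * rise z (2 ℕ.* n) * fall z n * factorial (3 ℕ.* n)

  -- The solution of the telescoping equation for the mate F, times 128 (2n + 1)³.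
  Q : ℤ → ℤ → ℤ
  Q n z = n * n * (+ 208 + n * (+ 1248 + n * (+ 2400 + n * + 1376)))
    + z * (n * (+ 96 + n * (+ 576 + n * (+ 984 + n * + 264)))
    + z * (+ 12 + n * (+ 72 + n * (+ 36 + - (n * + 228)))
    + - (z * (n * (+ 30 + n * + 90) + z * (+ 3 + + 9 * n)))))

  -- The ratio of `64ⁿ n!³ (2n + 1)!³` to its predecessor, namely `64 n³ (2n (2n + 1))³`.
  growth : ℤ → ℤ
  growth n = + 512 * (n * n * n * n * n * n) * ((+ 2 * n + + 1) * (+ 2 * n + + 1) * (+ 2 * n + + 1))

  -- T (suc r) z is 64ʳ r!³ (2r + 1)!³ times the partial sum of G(n, z) over n ≤ r.
  T : ℕ → ℤ → ℤ
  T zero    z = 0ℤ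
  T (suc n) z = growth (+ n) * T n z + kernel n z * Q (+ n) z

  -- The mate F(r + 1, z), multiplied by the same denominator, is flux r z.
  coboundary : ℕ → ℤ → ℤ
  coboundary r z = rise (z + + 2) r * rise (z + + 2) r * rise (z + + 2) r
    * rise (z + + 2) (suc (2 ℕ.* r)) * fall z r * factorial (2 ℕ.+ 3 ℕ.* r)

  flux : ℕ → ℤ → ℤ
  flux r z = - + 12 * (+ suc r + z) * z * coboundary r z

  private
    -- The Wilf-Zeilberger equation `F(n + 1, z) = F(n, z) + G(n, z + 2) - G(n, z)` after all common
    -- products are divided out. `Q` is written out so that what remains is an identity of
    -- polynomials.
    certificate : ∀ n z →
      + 12 * (+ 3 * n + + 1) * (+ 3 * n + + 2) * (n + + 1 + z)
        * ((z + + 2 * n) * (z + + 2 * n) * (z + + 2 * n)) * (z + + 4 * n) * (z + + 4 * n + + 2) * (+ 2 * n + - z)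
      ≡ - (n * n * n * n * n * (+ 2048 * ((+ 2 * n + + 1) * (+ 2 * n + + 1) * (+ 2 * n + + 1)) * (n + z)))
        + ((z + + 2 * n) * (z + + 2 * n) * (z + + 2 * n)) * (z + + 4 * n) *
          (n * n * (+ 208 + n * (+ 1248 + n * (+ 2400 + n * + 1376)))
          + (z + + 2) * (n * (+ 96 + n * (+ 576 + n * (+ 984 + n * + 264)))
          + (z + + 2) * (+ 12 + n * (+ 72 + n * (+ 36 + - (n * + 228)))
          + - ((z + + 2) * (n * (+ 30 + n * + 90) + (z + + 2) * (+ 3 + + 9 * n))))))
        + z * z * z * (+ 2 * n + - z) *
          (n * n * (+ 208 + n * (+ 1248 + n * (+ 2400 + n * + 1376)))
          + z * (n * (+ 96 + n * (+ 576 + n * (+ 984 + n * + 264)))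
          + z * (+ 12 + n * (+ 72 + n * (+ 36 + - (n * + 228)))
          + - (z * (n * (+ 30 + n * + 90) + z * (+ 3 + + 9 * n))))))
    certificate = solve-∀

    cast-+2* : ∀ m n → + (m ℕ.+ 2 ℕ.* n) ≡ + m + + 2 * + n
    cast-+2* m n = trans (pos-+ m (2 ℕ.* n)) (cong (λ k → + m + k) (pos-* 2 n))

    cast-+3* : ∀ m n → + (m ℕ.+ 3 ℕ.* n) ≡ + m + + 3 * + n
    cast-+3* m n = trans (pos-+ m (3 ℕ.* n)) (cong (λ k → + m + k) (pos-* 3 n))

  -- Shifting `z` by 2 amounts to shifting the index by 1. Hence the kernels at `z` and `z + 2` and
  -- the flux share almost all of their factors.
  rise-head : ∀ z n → rise z (suc n) ≡ z * rise (z + + 2) n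
  rise-head z n = trans (∏-head n _) (cong₂ _*_ (+-identityʳ z) (∏-cong n λ i _ → lemma z (+ i)))
    where
    lemma : ∀ z i → z + + 2 * (+ 1 + i) ≡ z + + 2 + + 2 * i
    lemma = solve-∀

  fall-head : ∀ z n → fall (z + + 2) (suc n) ≡ z * fall z n
  fall-head z n = trans (∏-head n _) (cong₂ _*_ (lemma₀ z) (∏-cong n λ i _ → lemma z (+ i)))
    where
    lemma₀ : ∀ z → z + + 2 + - + 2 ≡ z
    lemma₀ = solve-∀
    lemma : ∀ z i → z + + 2 + - (+ 2 * (+ 1 + (+ 1 + i))) ≡ z + - (+ 2 * (+ 1 + i))
    lemma = solve-∀

  -- Summing the Wilf-Zeilberger equation over the index leaves only the upper boundary term,
  -- because `F(0, z) = 0`. The inductive step is `certificate` multiplied by `3 ν z W`.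
  T-difference : ∀ r z → T (suc r) (z + + 2) ≡ T (suc r) z + flux r z
  T-difference zero    z = lemma z
    where
    lemma : ∀ z → 0ℤ + + 1 *
          (0ℤ + (z + + 2) * (0ℤ + (z + + 2) * (+ 12 + - ((z + + 2) * (0ℤ + (z + + 2) * + 3)))))
      ≡ (0ℤ + + 1 * (0ℤ + z * (0ℤ + z * (+ 12 + - (z * (0ℤ + z * + 3))))))
        + - + 12 * (+ 1 + z) * z * (+ 1 * (+ 1 * (z + + 2 + 0ℤ)) * + 1 * + 2)
    lemma = solve-∀
  T-difference (suc r) z = begin
    growth ν * T (suc r) (z + + 2) + kernel (suc r) (z + + 2) * Q ν (z + + 2)
      ≡⟨ cong₂ (λ t k → growth ν * t + k * Q ν (z + + 2)) (T-difference r z) kernel-shifted ⟩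
    growth ν * (t + - + 12 * (ν + z) * z * W) + + 3 * ν * z * W * (s * s * s * f) * Q ν (z + + 2)
      -- The summand at `z` is split off in the form of `kernel-here`. The bracket that remains is
      -- the right side of `certificate`.
      ≡⟨ regroup W ν z t (ν * ν * ν * ν * ν) (l * l * l) (ν + z) (s * s * s * f) (z * z * z * d) (Q ν (z + + 2)) (Q ν z) ⟩
    growth ν * t + - (+ 3 * ν * z * W * (z * z * z * d)) * Q ν z + + 3 * ν * z * W *
        (- (ν * ν * ν * ν * ν * (+ 2048 * (l * l * l) * (ν + z))) + s * s * s * f * Q ν (z + + 2) + z * z * z * d * Q ν z)
      ≡⟨ cong₂ (λ k c → growth ν * t + k * Q ν z + + 3 * ν * z * W * c)
           (sym kernel-here) (sym (certificate ν z)) ⟩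
    growth ν * t + kernel (suc r) z * Q ν z + + 3 * ν * z * W *
        (+ 12 * (+ 3 * ν + + 1) * (+ 3 * ν + + 2) * (ν + + 1 + z) * (s * s * s) * f * g * d)
      ≡⟨ cong (λ x → growth ν * t + kernel (suc r) z * Q ν z + x) flux-next ⟩
    growth ν * t + kernel (suc r) z * Q ν z + flux (suc r) z ∎
    where
    ν = + suc r
    t = T (suc r) z
    A = rise (z + + 2) r
    B = rise (z + + 2) (suc (2 ℕ.* r))
    C = fall z r
    E = factorial (2 ℕ.+ 3 ℕ.* r)
    -- This is `coboundary r z`. Both kernels at index `suc r` are `3 ν z W` times a polynomial in
    -- `ν` and `z`.
    W = A * A * A * B * C * E
    s = z + + 2 * ν
    f = z + + 4 * ν
    g = z + + 4 * ν + + 2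
    d = + 2 * ν + - z
    l = + 2 * ν + + 1

    regroup : ∀ W ν z t e l x σ τ q₁ q₂ →
      + 512 * (e * ν) * l * (t + - + 12 * x * z * W) + + 3 * ν * z * W * σ * q₁
      ≡ + 512 * (e * ν) * l * t + - (+ 3 * ν * z * W * τ) * q₂
        + + 3 * ν * z * W * (- (e * (+ 2048 * l * x)) + σ * q₁ + τ * q₂)
    regroup = solve-∀

    rise-last : rise (z + + 2) (suc r) ≡ A * s
    rise-last = cong (A *_) (lemma z (+ r))
      where
      lemma : ∀ z r → z + + 2 + + 2 * r ≡ z + + 2 * (+ 1 + r)
      lemma = solve-∀

    fall-last : fall z (suc r) ≡ C * - d
    fall-last = cong (C *_) (lemma z ν)
      where
      lemma : ∀ z n → z + - (+ 2 * n) ≡ - (+ 2 * n + - z)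
      lemma = solve-∀

    rise₂-last : rise (z + + 2) (2 ℕ.* suc r) ≡ B * f
    rise₂-last = trans (cong (rise (z + + 2)) (ℕ.*-suc 2 r))
      (cong (B *_) (trans (cong (λ k → z + + 2 + + 2 * k) (cast-+2* 1 r)) (lemma z (+ r))))
      where
      lemma : ∀ z r → z + + 2 + + 2 * (+ 1 + + 2 * r) ≡ z + + 4 * (+ 1 + r)
      lemma = solve-∀

    rise₃-last : rise (z + + 2) (suc (2 ℕ.* suc r)) ≡ B * f * g
    rise₃-last = cong₂ _*_ rise₂-last (trans (cong (λ k → z + + 2 + + 2 * k) (pos-* 2 (suc r))) (lemma z ν))
      where
      lemma : ∀ z n → z + + 2 + + 2 * (+ 2 * n) ≡ z + + 4 * n + + 2
      lemma = solve-∀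

    factorial-last : factorial (3 ℕ.* suc r) ≡ E * (+ 3 * ν)
    factorial-last = trans (cong factorial (ℕ.*-suc 3 r))
      (cong (E *_) (trans (cong +_ (sym (ℕ.*-suc 3 r))) (pos-* 3 (suc r))))

    factorial-next : factorial (2 ℕ.+ 3 ℕ.* suc r) ≡ E * (+ 3 * ν) * (+ 3 * ν + + 1) * (+ 3 * ν + + 2)
    factorial-next = cong₂ _*_ (cong₂ _*_ factorial-last
      (trans (cast-+3* 1 (suc r)) (+-comm (+ 1) (+ 3 * ν))))
      (trans (cast-+3* 2 (suc r)) (+-comm (+ 2) (+ 3 * ν)))

    kernel-shifted : kernel (suc r) (z + + 2) ≡ + 3 * ν * z * W * (s * s * s * f)
    kernel-shifted = trans
      (cong₂ _*_ (cong₂ _*_ (cong₂ (λ a b → a * a * a * b) rise-last rise₂-last) (fall-head z r)) factorial-last)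
      (lemma A B C E s f ν z)
      where
      lemma : ∀ A B C E s f ν z → A * s * (A * s) * (A * s) * (B * f) * (z * C) * (E * (+ 3 * ν))
        ≡ + 3 * ν * z * (A * A * A * B * C * E) * (s * s * s * f)
      lemma = solve-∀

    kernel-here : kernel (suc r) z ≡ - (+ 3 * ν * z * W * (z * z * z * d))
    kernel-here = trans
      (cong₂ _*_ (cong₂ _*_ (cong₂ (λ a b → a * a * a * b) (rise-head z r)
        (trans (cong (rise z) (ℕ.*-suc 2 r)) (rise-head z (suc (2 ℕ.* r))))) fall-last) factorial-last)
      (lemma A B C E d ν z)
      where
      lemma : ∀ A B C E d ν z → z * A * (z * A) * (z * A) * (z * B) * (C * - d) * (E * (+ 3 * ν))
        ≡ - (+ 3 * ν * z * (A * A * A * B * C * E) * (z * z * z * d))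
      lemma = solve-∀

    flux-next : + 3 * ν * z * W *
        (+ 12 * (+ 3 * ν + + 1) * (+ 3 * ν + + 2) * (ν + + 1 + z) * (s * s * s) * f * g * d)
      ≡ flux (suc r) z
    flux-next = sym (trans
      (cong (- + 12 * (+ 1 + ν + z) * z *_)
        (cong₂ _*_ (cong₂ _*_ (cong₂ (λ a b → a * a * a * b) rise-last rise₃-last) fall-last) factorial-next))
      (trans (lemma₁ A B C E s f g d (+ 3 * ν) (+ 3 * ν + + 1) (+ 3 * ν + + 2) (- + 12 * (+ 1 + ν + z) * z))
             (lemma₂ W ν z (s * s * s) f g d (+ 3 * ν + + 1) (+ 3 * ν + + 2))))
      where
      lemma₁ : ∀ A B C E s f g d ν k₁ k₂ m →
        m * (A * s * (A * s) * (A * s) * (B * f * g) * (C * - d) * (E * ν * k₁ * k₂))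
        ≡ - m * (A * A * A * B * C * E) * (s * s * s) * f * g * d * ν * k₁ * k₂
      lemma₁ = solve-∀
      lemma₂ : ∀ W ν z s f g d k₁ k₂ →
        - (- + 12 * (+ 1 + ν + z) * z) * W * s * f * g * d * (+ 3 * ν) * k₁ * k₂
        ≡ + 3 * ν * z * W * (+ 12 * k₁ * k₂ * (ν + + 1 + z) * s * f * g * d)
      lemma₂ = solve-∀

-- Divisibility by a prime.

module PrimeModulus where
  open import Data.Integer hiding (suc)
  open import Data.Integer.Properties
  open import Data.Nat.Primality using (Prime; euclidsLemma; prime⇒nonTrivial)
  import Data.Nat.Divisibility as ℕ
  open import Data.Integer.Divisibility.Signed using (divides; ∣ᵤ⇒∣)
  open import Data.Sum using (inj₁; inj₂)
  open import Relation.Binary.PropositionalEquality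
  open import Relation.Nullary using (¬_; contradiction)
  import Data.Nat.Properties as ℕ
  open FiniteProduct *-1-commutativeMonoid using (∏)
  open Congruence

  ∣⇒≅0 : ∀ {p a} → p ℕ.∣ ∣ a ∣ → a ≅ 0ℤ mod + p
  ∣⇒≅0 {p} {a} p∣a with ∣ᵤ⇒∣ {+ p} {a} p∣a
  ... | divides q a≡qp = modulo q (trans a≡qp (trans (*-comm q (+ p)) (sym (+-identityˡ _))))

  ≅0⇒∣ : ∀ {p a} → a ≅ 0ℤ mod + p → p ℕ.∣ ∣ a ∣
  ≅0⇒∣ {p} (modulo q refl) = ℕ.divides ∣ q ∣
    (trans (cong ∣_∣ (+-identityˡ (+ p * q))) (trans (abs-* (+ p) q) (ℕ.*-comm p ∣ q ∣)))

  *≅0⇒≅0ʳ : ∀ {p} → Prime p → ∀ a {b} → ¬ a ≅ 0ℤ mod + p → a * b ≅ 0ℤ mod + p → b ≅ 0ℤ mod + p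
  *≅0⇒≅0ʳ {p} pr a {b} a≇0 ab≅0
    with euclidsLemma ∣ a ∣ ∣ b ∣ pr (subst (p ℕ.∣_) (abs-* a b) (≅0⇒∣ ab≅0))
  ... | inj₁ p∣a = contradiction (∣⇒≅0 p∣a) a≇0
  ... | inj₂ p∣b = ∣⇒≅0 p∣b

  *≇0 : ∀ {p} → Prime p → ∀ {a b} → ¬ a ≅ 0ℤ mod + p → ¬ b ≅ 0ℤ mod + p → ¬ a * b ≅ 0ℤ mod + p
  *≇0 pr {a} a≇0 b≇0 ab≅0 = b≇0 (*≅0⇒≅0ʳ pr a a≇0 ab≅0)

  small≇0 : ∀ {p n} .{{_ : ℕ.NonZero n}} → n ℕ.< p → ¬ + n ≅ 0ℤ mod + p
  small≇0 n<p n≅0 = ℕ.>⇒∤ n<p (≅0⇒∣ n≅0)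

  ∏≇0 : ∀ {p} → Prime p → ∀ n f → (∀ i → i ℕ.< n → ¬ f i ≅ 0ℤ mod + p) → ¬ ∏ n f ≅ 0ℤ mod + p
  ∏≇0 pr zero    f f≇0 = small≇0 (ℕ.nonTrivial⇒n>1 _ {{prime⇒nonTrivial pr}})
  ∏≇0 pr (suc n) f f≇0 =
    *≇0 pr (∏≇0 pr n f λ i i<n → f≇0 i (ℕ.m<n⇒m<1+n i<n)) (f≇0 n (ℕ.n<1+n n))

-- Wolstenholme's congruence by way of polynomials truncated at degree two.

module Wolstenholme where
  open import Data.Integer hiding (suc)
  open import Data.Integer.Properties
  open import Data.Integer.Tactic.RingSolver
  open import Data.Nat.Primality using (Prime)
  open import Data.Product using (_×_; _,_; proj₁; proj₂)
  open import Level using (0ℓ)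
  open import Relation.Binary.PropositionalEquality hiding (setoid)
  open import Relation.Nullary using (¬_)
  import Data.Nat.Properties as ℕ
  open FiniteProduct *-1-commutativeMonoid
  open Congruence
  open PrimeModulus

  -- c₀ + c₁ X + c₂ X² modulo X³
  record Quadratic : Set where
    no-eta-equality
    pattern
    constructor quadratic
    field
      c₀ c₁ c₂ : ℤ

  open Quadratic

  infixl 7 _⊗_
  _⊗_ : Quadratic → Quadratic → Quadratic
  f ⊗ g = quadratic (c₀ f * c₀ g) (c₀ f * c₁ g + c₁ f * c₀ g) (c₀ f * c₂ g + c₁ f * c₁ g + c₂ f * c₀ g)

  infix 4 _≊_mod_
  record _≊_mod_ (f g : Quadratic) (m : ℤ) : Set where
    constructor coefficientwise
    field
      ≅₀ : c₀ f ≅ c₀ g mod m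
      ≅₁ : c₁ f ≅ c₁ g mod m
      ≅₂ : c₂ f ≅ c₂ g mod m

  open _≊_mod_

  -- With truncated polynomials as a commutative monoid under coefficientwise congruence, the
  -- reordering rules of `FiniteProduct` apply to products of linear factors.
  quadratics : ℤ → CommutativeMonoid 0ℓ 0ℓ
  quadratics m = record
    { Carrier = Quadratic
    ; _≈_ = _≊_mod m
    ; _∙_ = _⊗_
    ; ε = quadratic 1ℤ 0ℤ 0ℤ
    ; isCommutativeMonoid = record
      { isMonoid = record
        { isSemigroup = record
          { isMagma = record
            { isEquivalence = record
              { refl = coefficientwise ≅-refl ≅-refl ≅-refl
              ; sym = λ (coefficientwise e₀ e₁ e₂) → coefficientwise (≅-sym e₀) (≅-sym e₁) (≅-sym e₂)
              ; trans = λ (coefficientwise e₀ e₁ e₂) (coefficientwise f₀ f₁ f₂) →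
                  coefficientwise (≅-trans e₀ f₀) (≅-trans e₁ f₁) (≅-trans e₂ f₂)
              }
            ; ∙-cong = λ (coefficientwise e₀ e₁ e₂) (coefficientwise f₀ f₁ f₂) →
                coefficientwise (≅-* e₀ f₀) (≅-+ (≅-* e₀ f₁) (≅-* e₁ f₀))
                  (≅-+ (≅-+ (≅-* e₀ f₂) (≅-* e₁ f₁)) (≅-* e₂ f₀))
            }
          ; assoc = λ (quadratic a₀ a₁ a₂) (quadratic b₀ b₁ b₂) (quadratic d₀ d₁ d₂) →
              coefficientwise (≡⇒≅ (*-assoc a₀ b₀ d₀)) (≡⇒≅ (assoc₁ a₀ a₁ b₀ b₁ d₀ d₁)) (≡⇒≅ (assoc₂ a₀ a₁ a₂ b₀ b₁ b₂ d₀ d₁ d₂))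
          }
        ; identity =
            (λ (quadratic a₀ a₁ a₂) → coefficientwise (≡⇒≅ (*-identityˡ a₀)) (≡⇒≅ (identityˡ₁ a₀ a₁)) (≡⇒≅ (identityˡ₂ a₀ a₁ a₂)))
          , (λ (quadratic a₀ a₁ a₂) → coefficientwise (≡⇒≅ (*-identityʳ a₀)) (≡⇒≅ (identityʳ₁ a₀ a₁)) (≡⇒≅ (identityʳ₂ a₀ a₁ a₂)))
        }
      ; comm = λ (quadratic a₀ a₁ a₂) (quadratic b₀ b₁ b₂) →
          coefficientwise (≡⇒≅ (*-comm a₀ b₀)) (≡⇒≅ (comm₁ a₀ a₁ b₀ b₁)) (≡⇒≅ (comm₂ a₀ a₁ a₂ b₀ b₁ b₂))
      }
    }
    where
    assoc₁ : ∀ a₀ a₁ b₀ b₁ d₀ d₁ →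
      a₀ * b₀ * d₁ + (a₀ * b₁ + a₁ * b₀) * d₀ ≡ a₀ * (b₀ * d₁ + b₁ * d₀) + a₁ * (b₀ * d₀)
    assoc₁ = solve-∀
    assoc₂ : ∀ a₀ a₁ a₂ b₀ b₁ b₂ d₀ d₁ d₂ →
      a₀ * b₀ * d₂ + (a₀ * b₁ + a₁ * b₀) * d₁ + (a₀ * b₂ + a₁ * b₁ + a₂ * b₀) * d₀
      ≡ a₀ * (b₀ * d₂ + b₁ * d₁ + b₂ * d₀) + a₁ * (b₀ * d₁ + b₁ * d₀) + a₂ * (b₀ * d₀)
    assoc₂ = solve-∀
    identityˡ₁ : ∀ a₀ a₁ → 1ℤ * a₁ + 0ℤ * a₀ ≡ a₁
    identityˡ₁ = solve-∀
    identityˡ₂ : ∀ a₀ a₁ a₂ → 1ℤ * a₂ + 0ℤ * a₁ + 0ℤ * a₀ ≡ a₂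
    identityˡ₂ = solve-∀
    identityʳ₁ : ∀ a₀ a₁ → a₀ * 0ℤ + a₁ * 1ℤ ≡ a₁
    identityʳ₁ = solve-∀
    identityʳ₂ : ∀ a₀ a₁ a₂ → a₀ * 0ℤ + a₁ * 0ℤ + a₂ * 1ℤ ≡ a₂
    identityʳ₂ = solve-∀
    comm₁ : ∀ a₀ a₁ b₀ b₁ → a₀ * b₁ + a₁ * b₀ ≡ b₀ * a₁ + b₁ * a₀
    comm₁ = solve-∀
    comm₂ : ∀ a₀ a₁ a₂ b₀ b₁ b₂ → a₀ * b₂ + a₁ * b₁ + a₂ * b₀ ≡ b₀ * a₂ + b₁ * a₁ + b₂ * a₀
    comm₂ = solve-∀

  linear : ℤ → ℤ → Quadratic
  linear a b = quadratic a b 0ℤ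

  -- The product of the factors `a i + b X` modulo `X³`. It is defined independently of any modulus;
  -- `expand≡∏` identifies it with the product in each monoid `quadratics m`.
  expand : (ℕ → ℤ) → ℤ → ℕ → Quadratic
  expand a b zero    = quadratic 1ℤ 0ℤ 0ℤ
  expand a b (suc n) = expand a b n ⊗ linear (a n) b

  expand-c₀ : ∀ a b n → c₀ (expand a b n) ≡ ∏ n a
  expand-c₀ a b zero    = refl
  expand-c₀ a b (suc n) = cong (_* a n) (expand-c₀ a b n)

  expand-eval : ∀ a X n → let f = expand a 1ℤ n in
    ∏ n (λ i → a i + X) ≅ c₀ f + c₁ f * X + c₂ f * (X * X) mod (X * X * X)
  expand-eval a X zero    = ≡⇒≅ (lemma X)
    where
    lemma : ∀ X → 1ℤ ≡ 1ℤ + 0ℤ * X + 0ℤ * (X * X)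
    lemma = solve-∀
  expand-eval a X (suc n) with expand a 1ℤ n | expand-eval a X n
  -- Truncation discards the term `w X³`, and the old remainder `q X³` is multiplied by the new
  -- factor.
  ... | quadratic u v w | modulo q eq = modulo (w + q * (a n + X))
    (trans (cong (_* (a n + X)) eq) (lemma u v w q (a n) X))
    where
    lemma : ∀ u v w q a X → (u + v * X + w * (X * X) + X * X * X * q) * (a + X)
      ≡ u * a + (u * + 1 + v * a) * X + (u * 0ℤ + v * + 1 + w * a) * (X * X) + X * X * X * (w + q * (a + X))
    lemma = solve-∀

  -- Slope `b` results from substituting `b X` for `X` in the product with slope 1.
  expand-slope : ∀ a b n → c₂ (expand a b n) ≡ b * b * c₂ (expand a 1ℤ n) × c₁ (expand a b n) ≡ b * c₁ (expand a 1ℤ n)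
  expand-slope a b zero    = sym (*-zeroʳ (b * b)) , sym (*-zeroʳ b)
  expand-slope a b (suc n) with expand a b n | expand a 1ℤ n | expand-c₀ a b n | expand-c₀ a 1ℤ n | expand-slope a b n
  ... | quadratic _ _ _ | quadratic u v w | refl | refl | refl , refl =
    lemma₂ (a n) b u v w , lemma₁ (a n) b u v
    where
    lemma₁ : ∀ a b u v → u * b + b * v * a ≡ b * (u * + 1 + v * a)
    lemma₁ = solve-∀
    lemma₂ : ∀ a b u v w → u * 0ℤ + b * v * b + b * b * w * a ≡ b * b * (u * 0ℤ + v * + 1 + w * a)
    lemma₂ = solve-∀

  expand-scale : ∀ a b c n → let f = expand a b n; g = expand (λ i → c * a i) (c * b) n in
    c₀ g ≡ c ^ n * c₀ f × c₁ g ≡ c ^ n * c₁ f × c₂ g ≡ c ^ n * c₂ f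
  expand-scale a b c zero    = refl , refl , refl
  expand-scale a b c (suc n) with expand a b n | expand (λ i → c * a i) (c * b) n | expand-scale a b c n
  ... | quadratic u v w | quadratic _ _ _ | refl , refl , refl =
    lemma₀ (a n) c (c ^ n) u , lemma₁ (a n) b c (c ^ n) u v , lemma₂ (a n) b c (c ^ n) u v w
    where
    lemma₀ : ∀ a c e u → e * u * (c * a) ≡ c * e * (u * a)
    lemma₀ = solve-∀
    lemma₁ : ∀ a b c e u v → e * u * (c * b) + e * v * (c * a) ≡ c * e * (u * b + v * a)
    lemma₁ = solve-∀
    lemma₂ : ∀ a b c e u v w → e * u * 0ℤ + e * v * (c * b) + e * w * (c * a) ≡ c * e * (u * 0ℤ + v * b + w * a)
    lemma₂ = solve-∀

  expand≡∏ : ∀ m a b n → expand a b n ≡ FiniteProduct.∏ (quadratics m) n (λ i → linear (a i) b)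
  expand≡∏ m a b zero    = refl
  expand≡∏ m a b (suc n) = cong (_⊗ linear (a n) b) (expand≡∏ m a b n)

  -- Modulo p = 2k + 1 the numbers 2, 4, …, 4k are congruent to 2, 4, …, 2k, 1, 3, …, 2k - 1.
  doubling : ∀ k b → expand (λ i → + 2 * + suc i) b (k ℕ.+ k) ≊ expand (λ i → + suc i) b (k ℕ.+ k) mod + suc (k ℕ.+ k)
  doubling k b = begin
    expand (λ i → + 2 * + suc i) b (k ℕ.+ k)
      ≡⟨ expand≡∏ m _ b (k ℕ.+ k) ⟩
    P.∏ (k ℕ.+ k) (λ i → linear (+ 2 * + suc i) b)
      ≈⟨ P.∏-+ k k _ ⟩
    P.∏ k (λ i → linear (+ 2 * + suc i) b) ⊗ P.∏ k (λ i → linear (+ 2 * + suc (k ℕ.+ i)) b)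
      ≈⟨ ∙-cong (P.∏-cong k λ i _ → coefficientwise (≡⇒≅ (even i)) ≅-refl ≅-refl)
                (P.∏-cong k λ i _ → coefficientwise (modulo 1ℤ (odd i)) ≅-refl ≅-refl) ⟩
    P.∏ k (λ i → linear (+ suc (suc (i ℕ.+ i))) b) ⊗ P.∏ k (λ i → linear (+ suc (i ℕ.+ i)) b)
      ≈⟨ comm (P.∏ k (λ i → linear (+ suc (suc (i ℕ.+ i))) b)) (P.∏ k (λ i → linear (+ suc (i ℕ.+ i)) b)) ⟩
    P.∏ k (λ i → linear (+ suc (i ℕ.+ i)) b) ⊗ P.∏ k (λ i → linear (+ suc (suc (i ℕ.+ i))) b)
      ≈⟨ P.∏-interleave k _ ⟨
    P.∏ (k ℕ.+ k) (λ i → linear (+ suc i) b)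
      ≡⟨ expand≡∏ m _ b (k ℕ.+ k) ⟨
    expand (λ i → + suc i) b (k ℕ.+ k) ∎
    where
    m = + suc (k ℕ.+ k)
    open CommutativeMonoid (quadratics m) using (setoid; ∙-cong; comm)
    open import Relation.Binary.Reasoning.Setoid setoid
    module P = FiniteProduct (quadratics m)
    even : ∀ i → + 2 * + suc i ≡ + suc (suc (i ℕ.+ i))
    even i = lemma (+ i)
      where
      lemma : ∀ i → + 2 * (+ 1 + i) ≡ + 2 + (i + i)
      lemma = solve-∀
    odd : ∀ i → + 2 * + suc (k ℕ.+ i) ≡ + suc (i ℕ.+ i) + + suc (k ℕ.+ k) * 1ℤ
    odd i = lemma (+ i) (+ k)
      where
      lemma : ∀ i k → + 2 * (+ 1 + (k + i)) ≡ + 1 + (i + i) + (+ 1 + (k + k)) * + 1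
      lemma = solve-∀

  -- Computing `e * u * c` in two ways gives `u * c` and `4 * u * c`, whose difference must vanish.
  -- The value of `e` modulo `p` does not enter.
  eliminate-power : ∀ {e u c p} → e * u ≅ u mod p → e * c ≅ + 2 * + 2 * c mod p → u * (+ 3 * c) ≅ 0ℤ mod p
  eliminate-power {e} {u} {c} {p} (modulo s eq₀) (modulo t eq₂) = modulo (s * c + - (u * t)) (begin
    u * (+ 3 * c)                                        ≡⟨ lemma₁ u c t p ⟩
    u * (+ 2 * + 2 * c + p * t) + - (p * t * u + u * c)  ≡⟨ cong (λ x → u * x + - (p * t * u + u * c)) eq₂ ⟨
    u * (e * c) + - (p * t * u + u * c)                  ≡⟨ lemma₂ u c t p e ⟩
    e * u * c + - (p * t * u + u * c)                    ≡⟨ cong (λ x → x * c + - (p * t * u + u * c)) eq₀ ⟩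
    (u + p * s) * c + - (p * t * u + u * c)              ≡⟨ lemma₃ u c s t p ⟩
    0ℤ + p * (s * c + - (u * t))                         ∎)
    where
    open ≡-Reasoning
    lemma₁ : ∀ u c t p → u * (+ 3 * c) ≡ u * (+ 2 * + 2 * c + p * t) + - (p * t * u + u * c)
    lemma₁ = solve-∀
    lemma₂ : ∀ u c t p e → u * (e * c) + - (p * t * u + u * c) ≡ e * u * c + - (p * t * u + u * c)
    lemma₂ = solve-∀
    lemma₃ : ∀ u c s t p → (u + p * s) * c + - (p * t * u + u * c) ≡ 0ℤ + p * (s * c + - (u * t))
    lemma₃ = solve-∀

  -- Here c₀ + c₁ X + c₂ X² takes the value c₀ at X = - p up to a multiple of p³.
  c₁≅0-from : ∀ {p u c₁ c₂} .{{_ : NonZero p}} →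
    u ≅ u + c₁ * - p + c₂ * (- p * - p) mod (- p * - p * - p) → c₂ ≅ 0ℤ mod p → c₁ ≅ 0ℤ mod (p * p)
  c₁≅0-from {p} {u} {c₁} {c₂} (modulo q eq) (modulo e c₂≡) = modulo (e + - q) (*-cancelˡ-≡ p _ _ (begin
    p * c₁                        ≡⟨ lemma₁ c₁ p u ⟩
    u + - (u + c₁ * - p)          ≡⟨ cong (λ x → x + - (u + c₁ * - p)) eq ⟩
    u + c₁ * - p + c₂ * (- p * - p) + - p * - p * - p * q + - (u + c₁ * - p)
      ≡⟨ cong (λ y → u + c₁ * - p + y * (- p * - p) + - p * - p * - p * q + - (u + c₁ * - p)) c₂≡ ⟩
    u + c₁ * - p + (0ℤ + p * e) * (- p * - p) + - p * - p * - p * q + - (u + c₁ * - p)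
      ≡⟨ lemma₂ c₁ p u e q ⟩
    p * (0ℤ + p * p * (e + - q))  ∎))
    where
    open ≡-Reasoning
    lemma₁ : ∀ c p u → p * c ≡ u + - (u + c * - p)
    lemma₁ = solve-∀
    lemma₂ : ∀ c p u e q → u + c * - p + (0ℤ + p * e) * (- p * - p) + - p * - p * - p * q + - (u + c * - p)
      ≡ p * (0ℤ + p * p * (e + - q))
    lemma₂ = solve-∀

  -- At `X = p x` the linear term, the quadratic term and the remainder are each multiples of `p³`.
  evaluate-at-multiple : ∀ {p x y u c₁ c₂} → c₁ ≅ 0ℤ mod (p * p) → c₂ ≅ 0ℤ mod p →
    y ≅ u + c₁ * (p * x) + c₂ * (p * x * (p * x)) mod (p * x * (p * x) * (p * x)) → y ≅ u mod (p * p * p)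
  evaluate-at-multiple {p} {x} {u = u} (modulo d refl) (modulo e refl) (modulo q refl) =
    modulo (d * x + e * x * x + x * x * x * q) (lemma p x u d e q)
    where
    lemma : ∀ p x u d e q → u + (0ℤ + p * p * d) * (p * x) + (0ℤ + p * e) * (p * x * (p * x)) + p * x * (p * x) * (p * x) * q
      ≡ u + p * p * p * (d * x + e * x * x + x * x * x * q)
    lemma = solve-∀

  module _ (k : ℕ) (p-prime : Prime (suc (k ℕ.+ k))) (3<p : 3 ℕ.< suc (k ℕ.+ k)) where
    private
      r = k ℕ.+ k
      p = + suc r
      f = expand (λ i → + suc i) 1ℤ r
      u = ∏ r λ i → + suc i

    factorial≇0 : ¬ u ≅ 0ℤ mod p
    factorial≇0 = ∏≇0 p-prime r _ λ i i<r → small≇0 (ℕ.s≤s i<r)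

    -- Multiplication by 2 permutes the nonzero residues. Comparing coefficients in `doubling` gives
    -- `2ʳ u ≅ u` and `2ʳ c₂ ≅ 4 c₂`, so `p` divides `3 u c₂`; as `3 < p`, it divides neither 3 nor
    -- `u`.
    c₂≅0 : c₂ f ≅ 0ℤ mod p
    c₂≅0 = *≅0⇒≅0ʳ p-prime (+ 3) (small≇0 3<p) (*≅0⇒≅0ʳ p-prime u factorial≇0 3uc₂≅0)
      where
      scaled = expand-scale (λ i → + suc i) 1ℤ (+ 2) r
      e₀ : (+ 2) ^ r * u ≅ u mod p
      e₀ = subst₂ (_≅_mod p)
        (trans (proj₁ scaled) (cong ((+ 2) ^ r *_) (expand-c₀ _ _ r)))
        (expand-c₀ _ _ r)
        (≅₀ (doubling k (+ 2)))
      e₂ : (+ 2) ^ r * c₂ f ≅ + 2 * + 2 * c₂ f mod p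
      e₂ = subst₂ (_≅_mod p)
        (proj₂ (proj₂ scaled))
        (proj₁ (expand-slope (λ i → + suc i) (+ 2) r))
        (≅₂ (doubling k (+ 2)))
      3uc₂≅0 : u * (+ 3 * c₂ f) ≅ 0ℤ mod p
      3uc₂≅0 = eliminate-power {(+ 2) ^ r} {u} {c₂ f} e₀ e₂

    -- The map sending `j` to `p - j` reverses the factors up to sign, and the number `r = k + k` of
    -- signs is even.
    reflected : ∏ r (λ i → + suc i + - p) ≡ u
    reflected = begin
      ∏ r (λ i → + suc i + - p)                                    ≡⟨ ∏-cong r factor ⟩
      ∏ r (λ i → -1ℤ * + suc (r ℕ.∸ suc i))                        ≡⟨ ∏-∙ r (λ _ → -1ℤ) (λ i → + suc (r ℕ.∸ suc i)) ⟩
      ∏ r (λ _ → -1ℤ) * ∏ r (λ i → + suc (r ℕ.∸ suc i))            ≡⟨ cong₂ _*_ even-sign (∏-reverse r (λ i → + suc i)) ⟩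
      1ℤ * u                                                       ≡⟨ *-identityˡ u ⟩
      u                                                            ∎
      where
      open ≡-Reasoning
      factor : ∀ i → i ℕ.< r → + suc i + - p ≡ -1ℤ * + suc (r ℕ.∸ suc i)
      factor i i<r = trans (cong (λ n → + suc i + - + suc n) (sym (ℕ.m+[n∸m]≡n i<r))) (lemma (+ i) (+ (r ℕ.∸ suc i)))
        where
        lemma : ∀ i j → + 1 + i + - (+ 1 + (+ 1 + i + j)) ≡ -1ℤ * (+ 1 + j)
        lemma = solve-∀
      even-sign : ∏ r (λ _ → -1ℤ) ≡ 1ℤ
      even-sign = trans (∏-+ k k _) (trans (sym (∏-∙ k _ _)) (∏-1 k))
        where
        ∏-1 : ∀ n → ∏ n (λ _ → 1ℤ) ≡ 1ℤ
        ∏-1 zero    = refl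
        ∏-1 (suc n) = trans (*-identityʳ _) (∏-1 n)

    -- This is the harmonic form of Wolstenholme's theorem: `c₁ f` equals `(p - 1)!` times
    -- `1 + 1/2 + ⋯ + 1/(p - 1)`. By `reflected`, the product takes the same value at `X = - p` as
    -- at `X = 0`.
    c₁≅0 : c₁ f ≅ 0ℤ mod (p * p)
    c₁≅0 = c₁≅0-from
      (subst₂ (λ y v → y ≅ v + c₁ f * - p + c₂ f * (- p * - p) mod (- p * - p * - p))
        reflected (expand-c₀ (λ i → + suc i) 1ℤ r) (expand-eval (λ i → + suc i) (- p) r))
      c₂≅0

    wolstenholme : ∀ x → ∏ r (λ i → + suc i + p * x) ≅ u mod (p * p * p)
    wolstenholme x = evaluate-at-multiple c₁≅0 c₂≅0
      (subst (λ v → ∏ r (λ i → + suc i + p * x) ≅ v + c₁ f * (p * x) + c₂ f * (p * x * (p * x)) mod (p * x * (p * x) * (p * x)))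
        (expand-c₀ (λ i → + suc i) 1ℤ r) (expand-eval (λ i → + suc i) (p * x) r))

-- The starting value at zero, dependence on z, and the common denominator.

module Evaluation where
  open import Data.Integer hiding (suc)
  open import Data.Integer.Properties
  open import Data.Integer.Tactic.RingSolver
  open import Relation.Binary.PropositionalEquality
  import Data.Nat.Properties as ℕ
  open FiniteProduct *-1-commutativeMonoid
  open Congruence
  open WilfZeilberger

  -- For positive index the product `rise` at `z = 0` begins with the factor 0. For index 0 it is
  -- `Q` that vanishes.
  T-zero : ∀ n → T n 0ℤ ≡ 0ℤ
  T-zero zero          = refl
  T-zero (suc zero)    = refl
  T-zero (suc (suc n)) = begin
    growth (+ suc n) * T (suc n) 0ℤ + kernel (suc n) 0ℤ * Q (+ suc n) 0ℤ
      ≡⟨ cong₂ (λ t a → growth (+ suc n) * t + a * a * a * b * c * d * Q (+ suc n) 0ℤ)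
           (T-zero (suc n)) (trans (rise-head 0ℤ n) (*-zeroˡ (rise (+ 2) n))) ⟩
    growth (+ suc n) * 0ℤ + 0ℤ * 0ℤ * 0ℤ * b * c * d * Q (+ suc n) 0ℤ
      ≡⟨ lemma (growth (+ suc n)) b c d (Q (+ suc n) 0ℤ) ⟩
    0ℤ ∎
    where
    open ≡-Reasoning
    b = rise 0ℤ (2 ℕ.* suc n)
    c = fall 0ℤ (suc n)
    d = factorial (3 ℕ.* suc n)
    lemma : ∀ g b c d q → g * 0ℤ + 0ℤ * 0ℤ * 0ℤ * b * c * d * q ≡ 0ℤ
    lemma = solve-∀

  rise-≅ : ∀ {z z′ m} n → z ≅ z′ mod m → rise z n ≅ rise z′ n mod m
  rise-≅ n z≅z′ = ≅-∏ n λ i → ≅-+ z≅z′ (≅-refl {+ 2 * + i})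

  fall-≅ : ∀ {z z′ m} n → z ≅ z′ mod m → fall z n ≅ fall z′ n mod m
  fall-≅ n z≅z′ = ≅-∏ n λ i → ≅-+ z≅z′ (≅-refl { - (+ 2 * + suc i)})

  kernel-≅ : ∀ {z z′ m} n → z ≅ z′ mod m → kernel n z ≅ kernel n z′ mod m
  kernel-≅ n z≅z′ = ≅-* (≅-* (≅-* (≅-* (≅-* a a) a) (rise-≅ (2 ℕ.* n) z≅z′)) (fall-≅ n z≅z′)) (≅-refl {factorial (3 ℕ.* n)})
    where a = rise-≅ n z≅z′

  Q-≅ : ∀ {z z′ m} n → z ≅ z′ mod m → Q n z ≅ Q n z′ mod m
  Q-≅ {z} {z′} n e =
    ≅-+ {n * n * (+ 208 + n * (+ 1248 + n * (+ 2400 + n * + 1376)))} ≅-refl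
    (≅-* e (≅-+ {n * (+ 96 + n * (+ 576 + n * (+ 984 + n * + 264)))} ≅-refl
    (≅-* e (≅-+ {+ 12 + n * (+ 72 + n * (+ 36 + - (n * + 228)))} ≅-refl
    (≅-neg (≅-* e (≅-+ {n * (+ 30 + n * + 90)} ≅-refl (≅-* e (≅-refl {+ 3 + + 9 * n})))))))))

  -- Holds because `T n` is a polynomial in `z` with integer coefficients. This is the integer
  -- counterpart of `p`-adic continuity.
  T-≅ : ∀ {z z′ m} n → z ≅ z′ mod m → T n z ≅ T n z′ mod m
  T-≅ zero    z≅z′ = ≅-refl
  T-≅ (suc n) z≅z′ = ≅-+ (≅-* (≅-refl {growth (+ n)}) (T-≅ n z≅z′)) (≅-* (kernel-≅ n z≅z′) (Q-≅ (+ n) z≅z′))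

  -- This is `64ⁿ n!³ (2n + 1)!³`. The recursion multiplies by `growth` from index 1 on, since
  -- `growth` vanishes at 0.
  denominator : ℕ → ℤ
  denominator zero    = 1ℤ
  denominator (suc n) = growth (+ suc n) * denominator n

  twos : ℕ → ℤ
  twos n = ∏ n λ _ → + 2

  denominator-factorial : ∀ n → let a = twos n; b = factorial n; c = factorial (suc (2 ℕ.* n)) in
    denominator n ≡ a * a * a * (a * a * a) * (b * b * b) * (c * c * c)
  denominator-factorial zero    = refl
  denominator-factorial (suc n) = begin
    growth ν * denominator n
      ≡⟨ cong (growth ν *_) (denominator-factorial n) ⟩
    growth ν * (a * a * a * (a * a * a) * (b * b * b) * (c * c * c))
      ≡⟨ lemma a b c ν (+ 2 * ν + + 1) ⟩
    g (a * + 2) (b * ν) (c * (+ 2 * ν) * (+ 2 * ν + + 1))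
      ≡⟨ cong (g (a * + 2) (b * ν)) factorial-next ⟨
    g (a * + 2) (b * ν) (factorial (suc (2 ℕ.* suc n))) ∎
    where
    open ≡-Reasoning
    ν = + suc n
    a = twos n
    b = factorial n
    c = factorial (suc (2 ℕ.* n))
    g : ℤ → ℤ → ℤ → ℤ
    g a b c = a * a * a * (a * a * a) * (b * b * b) * (c * c * c)
    lemma : ∀ a b c ν l → + 512 * (ν * ν * ν * ν * ν * ν) * (l * l * l) * (a * a * a * (a * a * a) * (b * b * b) * (c * c * c))
      ≡ a * + 2 * (a * + 2) * (a * + 2) * (a * + 2 * (a * + 2) * (a * + 2)) * (b * ν * (b * ν) * (b * ν))
        * (c * (+ 2 * ν) * l * (c * (+ 2 * ν) * l) * (c * (+ 2 * ν) * l))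
    lemma = solve-∀
    factorial-next : factorial (suc (2 ℕ.* suc n)) ≡ c * (+ 2 * ν) * (+ 2 * ν + + 1)
    factorial-next = cong₂ _*_
      (trans (cong factorial (ℕ.*-suc 2 n)) (cong (c *_) (trans (cong +_ (sym (ℕ.*-suc 2 n))) (pos-* 2 (suc n)))))
      (trans (pos-+ 1 (2 ℕ.* suc n)) (trans (cong (λ x → + 1 + x) (pos-* 2 (suc n))) (+-comm (+ 1) (+ 2 * ν))))

open import Data.Nat.Primality using (Prime)

-- The deformed sum modulo the eighth power of a prime above 3.

module AtPrime (k : ℕ) (p-prime : Prime (suc (k ℕ.+ k))) (3<p : 3 ℕ.< suc (k ℕ.+ k)) where
  open import Data.Integer hiding (suc)
  open import Data.Integer.Properties
  open import Data.Integer.Tactic.RingSolver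
  open import Data.Product using (∃-syntax; _,_; proj₁; proj₂)
  open import Relation.Binary.PropositionalEquality
  open import Relation.Nullary using (¬_)
  import Data.Nat.Properties as ℕ
  import Data.Nat.Tactic.RingSolver as ℕ-Solver
  open FiniteProduct *-1-commutativeMonoid
  open Congruence
  open PrimeModulus
  open Wolstenholme
  open WilfZeilberger
  open Evaluation

  r : ℕ
  r = k ℕ.+ k

  p u a : ℤ
  p = + suc r
  u = factorial r
  a = twos r

  p³ p⁵ p⁸ : ℤ
  p³ = p * p * p
  p⁵ = p * p * p * p * p
  p⁸ = p⁵ * p³

  -- A complete block of nonzero residues, translated by a multiple of `p`. All products below are
  -- cut into such blocks and isolated multiples of `p`.
  H : ℤ → ℤ
  H x = ∏ r λ i → + suc i + p * x

  H≅u : ∀ x → H x ≅ u mod p³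
  H≅u = wolstenholme k p-prime 3<p

  -- The length is `2 p - 1 = p + r`; the factor singled out stands at position `p`, counting from
  -- 1.
  ∏-two-blocks : ∀ f → ∏ (suc (2 ℕ.* r)) f ≡ ∏ r f * f r * ∏ r (λ i → f (suc r ℕ.+ i))
  ∏-two-blocks f = trans (cong (λ n → ∏ (suc r ℕ.+ n) f) (ℕ.+-identityʳ r)) (∏-+ (suc r) r f)

  -- The length is `3 p - 1`; the factors singled out stand at positions `p` and `2 p`.
  ∏-three-blocks : ∀ f → ∏ (2 ℕ.+ 3 ℕ.* r) f
    ≡ ∏ r f * f r * (∏ r (λ i → f (suc r ℕ.+ i)) * f (suc r ℕ.+ r) * ∏ r (λ i → f (suc r ℕ.+ (suc r ℕ.+ i))))
  ∏-three-blocks f = trans (cong (λ n → ∏ n f) (lemma r))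
    (trans (∏-+ (suc r) (suc r ℕ.+ r) f) (cong (∏ (suc r) f *_) (∏-+ (suc r) r (λ i → f (suc r ℕ.+ i)))))
    where
    lemma : ∀ r → 2 ℕ.+ 3 ℕ.* r ≡ suc r ℕ.+ (suc r ℕ.+ r)
    lemma = ℕ-Solver.solve-∀

  ∏-scale : ∀ c x f → (∀ i → f i ≡ c * (+ suc i + p * x)) → ∏ r f ≡ ∏ r (λ _ → c) * H x
  ∏-scale c x f eq = trans (∏-cong r λ i _ → eq i) (∏-∙ r (λ _ → c) (λ i → + suc i + p * x))

  multiple : ∀ {x} q → x ≡ p * q → x ≅ 0ℤ mod p
  multiple q x≡pq = modulo q (trans x≡pq (sym (+-identityˡ _)))

  factorial≅0 : factorial (2 ℕ.+ 3 ℕ.* r) ≅ 0ℤ mod (p * p)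
  factorial≅0 = subst (_≅ 0ℤ mod (p * p)) (sym (∏-three-blocks λ i → + suc i))
    (0≅-* (≅0-*ˡ (∏ r λ i → + suc i) (multiple 1ℤ (sym (*-identityʳ p))))
      (≅0-*ʳ (∏ r λ i → + suc (suc r ℕ.+ (suc r ℕ.+ i)))
        (≅0-*ˡ (∏ r λ i → + suc (suc r ℕ.+ i)) (multiple (+ 2) (lemma (+ r))))))
    where
    lemma : ∀ r → + 1 + (+ 1 + r + r) ≡ (+ 1 + r) * + 2
    lemma = solve-∀

  -- Eight factors `p` are found: one in each of the three short `rise` products, two in the long
  -- one, one in `fall`, and two in `(3p - 1)!`. Three of them match those of the denominator, which
  -- leaves `p⁵`.
  flux≅0 : ∀ x s → s ℕ.< r → flux r (- (+ 2 * (p * x + + suc s))) ≅ 0ℤ mod p⁸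
  flux≅0 x s s<r = ≅0-*ˡ (- + 12 * (p + z) * z)
    (subst (coboundary r z ≅ 0ℤ mod_) (regroup p)
      (0≅-* (0≅-* (0≅-* (0≅-* (0≅-* A≅0 A≅0) A≅0) B≅0) C≅0) factorial≅0))
    where
    z = - (+ 2 * (p * x + + suc s))

    regroup : ∀ p → p * p * p * (p * p) * p * (p * p) ≡ p * p * p * p * p * (p * p * p)
    regroup = solve-∀

    A≅0 : rise (z + + 2) r ≅ 0ℤ mod p
    A≅0 = ∏≅0 r _ s s<r (multiple (- (+ 2 * x)) (lemma p x (+ s)))
      where
      lemma : ∀ p x s → - (+ 2 * (p * x + (+ 1 + s))) + + 2 + + 2 * s ≡ p * - (+ 2 * x)
      lemma = solve-∀

    B≅0 : rise (z + + 2) (suc (2 ℕ.* r)) ≅ 0ℤ mod (p * p)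
    B≅0 = subst (_≅ 0ℤ mod (p * p)) (sym (∏-two-blocks λ i → z + + 2 + + 2 * + i))
      (0≅-* (≅0-*ʳ (z + + 2 + + 2 * + r) A≅0)
        (∏≅0 r (λ i → z + + 2 + + 2 * + (suc r ℕ.+ i)) s s<r (multiple (+ 2 + - (+ 2 * x)) (lemma p x (+ s)))))
      where
      lemma : ∀ p x s → - (+ 2 * (p * x + (+ 1 + s))) + + 2 + + 2 * (p + s) ≡ p * (+ 2 + - (+ 2 * x))
      lemma = solve-∀

    C≅0 : fall z r ≅ 0ℤ mod p
    C≅0 = ∏≅0 r (λ i → z - + 2 * + suc i) t t<r (multiple (- (+ 2 * (x + + 1)))
      (trans (lemma p x (+ s) (+ t)) (trans (cong (λ n → - (+ 2 * (p * x + + suc n))) t+1+s≡r) (lemma₂ p x))))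
      where
      t = r ℕ.∸ suc s
      t+1+s≡r : t ℕ.+ suc s ≡ r
      t+1+s≡r = ℕ.m∸n+n≡m s<r
      t<r : t ℕ.< r
      t<r = ℕ.∸-monoʳ-< ℕ.z<s s<r
      lemma : ∀ p x s t → - (+ 2 * (p * x + (+ 1 + s))) + - (+ 2 * (+ 1 + t)) ≡ - (+ 2 * (p * x + (+ 1 + (t + (+ 1 + s)))))
      lemma = solve-∀
      lemma₂ : ∀ p x → - (+ 2 * (p * x + p)) ≡ p * - (+ 2 * (x + + 1))
      lemma₂ = solve-∀

  -- This is `64ʳ (p - 1)!⁹`, the common residue modulo `p³` of the block products in the flux and
  -- of the part `unit` of the denominator.
  w : ℤ
  w = a * a * a * (a * a * a) * (u * u * u * (u * u * u) * (u * u * u))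

  -- Here five factors `p` are explicit: two in `(p + z) * z`, one in the long `rise`, two in
  -- `(3p - 1)!`. The other factors form nine blocks, each congruent to `u` modulo `p³`, so the
  -- product is determined modulo `p⁸`.
  flux-at-multiple : ∀ x → flux r (- (+ 2 * (p * x))) ≅ p⁵ * (+ 96 * (x * (x - + 1) * (+ 2 * x - + 1)) * w) mod p⁸
  flux-at-multiple x = subst (_≅ p⁵ * (+ 96 * g * w) mod p⁸) (sym flux≡)
    (≅-scale p⁵ (≅-* (≅-refl {+ 96 * g}) (≅-* (≅-refl {a * a * a * (a * a * a)})
      (≅-* (≅-* (≅-* (≅-* h₁ h₁) h₁) (≅-* (≅-* h₁ (H≅u (+ 1 + - x))) (H≅u x)))
        (≅-* (≅-* (≅-refl {u}) (H≅u (+ 1))) (H≅u (+ 2)))))))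
    where
    z = - (+ 2 * (p * x))
    g = x * (x - + 1) * (+ 2 * x - + 1)
    h₁ = H≅u (- x)

    A≡ : rise (z + + 2) r ≡ a * H (- x)
    A≡ = ∏-scale (+ 2) (- x) _ λ i → lemma p x (+ i)
      where
      lemma : ∀ p x i → - (+ 2 * (p * x)) + + 2 + + 2 * i ≡ + 2 * (+ 1 + i + p * - x)
      lemma = solve-∀

    B≡ : rise (z + + 2) (suc (2 ℕ.* r)) ≡ a * H (- x) * (+ 2 * p * (+ 1 + - x)) * (a * H (+ 1 + - x))
    B≡ = trans (∏-two-blocks λ i → z + + 2 + + 2 * + i) (cong₂ _*_ (cong₂ _*_ A≡ (lemma₁ (+ r) x))
      (∏-scale (+ 2) (+ 1 + - x) _ λ i → lemma₂ p x (+ i)))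
      where
      lemma₁ : ∀ r x → - (+ 2 * ((+ 1 + r) * x)) + + 2 + + 2 * r ≡ + 2 * (+ 1 + r) * (+ 1 + - x)
      lemma₁ = solve-∀
      lemma₂ : ∀ p x i → - (+ 2 * (p * x)) + + 2 + + 2 * (p + i) ≡ + 2 * (+ 1 + i + p * (+ 1 + - x))
      lemma₂ = solve-∀

    C≡ : fall z r ≡ a * H x
    C≡ = trans (∏-scale (- + 2) x _ λ i → lemma p x (+ i)) (cong (_* H x) signs)
      where
      lemma : ∀ p x i → - (+ 2 * (p * x)) + - (+ 2 * (+ 1 + i)) ≡ - + 2 * (+ 1 + i + p * x)
      lemma = solve-∀
      -- The number of factors `r = k + k` is even.
      signs : ∏ r (λ _ → - + 2) ≡ a
      signs = trans (∏-+ k k _) (trans (sym (∏-∙ k _ _)) (trans (∏-∙ k (λ _ → + 2) (λ _ → + 2)) (sym (∏-+ k k _))))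

    E≡ : factorial (2 ℕ.+ 3 ℕ.* r) ≡ u * p * (H (+ 1) * (p * + 2) * H (+ 2))
    E≡ = trans (∏-three-blocks λ i → + suc i) (cong (u * p *_) (cong₂ _*_
      (cong₂ _*_ (∏-cong r λ i _ → lemma₁ p (+ i)) (lemma₂ (+ r))) (∏-cong r λ i _ → lemma₃ p (+ i))))
      where
      lemma₁ : ∀ p i → + 1 + (p + i) ≡ + 1 + i + p * + 1
      lemma₁ = solve-∀
      lemma₂ : ∀ r → + 1 + (+ 1 + r + r) ≡ (+ 1 + r) * + 2
      lemma₂ = solve-∀
      lemma₃ : ∀ p i → + 1 + (p + (p + i)) ≡ + 1 + i + p * + 2
      lemma₃ = solve-∀

    flux≡ : flux r z ≡ p⁵ * (+ 96 * g * (a * a * a * (a * a * a) *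
      (H (- x) * H (- x) * H (- x) * (H (- x) * H (+ 1 + - x) * H x) * (u * H (+ 1) * H (+ 2)))))
    flux≡ = trans (cong (- + 12 * (p + z) * z *_) (cong₂ _*_ (cong₂ _*_ (cong₂ (λ a b → a * a * a * b) A≡ B≡) C≡) E≡))
      (lemma p x a (H (- x)) (H (+ 1 + - x)) (H x) u (H (+ 1)) (H (+ 2)))
      where
      lemma : ∀ p x a b c d u e f →
        - + 12 * (p + - (+ 2 * (p * x))) * (- (+ 2 * (p * x))) *
          (a * b * (a * b) * (a * b) * (a * b * (+ 2 * p * (+ 1 + - x)) * (a * c)) * (a * d) * (u * p * (e * (p * + 2) * f)))
        ≡ p * p * p * p * p * (+ 96 * (x * (x + - + 1) * (+ 2 * x + - + 1)) * (a * a * a * (a * a * a) *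
          (b * b * b * (b * c * d) * (u * e * f))))
      lemma = solve-∀

  T-step : ∀ z → T (suc r) z ≡ T (suc r) (z + + 2) + - flux r z
  T-step z = trans (lemma (T (suc r) z) (flux r z)) (cong (_+ - flux r z) (sym (T-difference r z)))
    where
    lemma : ∀ t f → t ≡ t + f + - f
    lemma = solve-∀

  -- The walk from 0 by steps of -2, indexed by quotient and remainder of the number of steps on
  -- division by `p`.
  position : ℕ → ℕ → ℤ
  position i s = - (+ 2 * (p * + i + + s))

  -- The polynomial `48 x² (x² - 1)` is the sum of `96 j (j - 1) (2j - 1)` over `1 ≤ j ≤ x`. The
  -- sign is negative because the walk subtracts the flux.
  value : ℤ → ℤ
  value x = p⁵ * (- (+ 48 * (x * x * (x * x - + 1))) * w)

  -- Between two multiples of `p` every flux vanishes by `flux≅0`, so `T` stays constant modulo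
  -- `p⁸`.
  T-within-block : ∀ i s → s ℕ.≤ r →
    T (suc r) (position i 0) ≅ value (+ i) mod p⁸ → T (suc r) (position i s) ≅ value (+ i) mod p⁸
  T-within-block i zero    _   T≅ = T≅
  T-within-block i (suc s) s<r T≅ = subst₂ (_≅_mod p⁸)
    (sym (trans (T-step (position i (suc s))) (cong (λ z → T (suc r) z + - flux r (position i (suc s))) (lemma p (+ i) (+ s)))))
    (+-identityʳ _)
    (≅-+ (T-within-block i s (ℕ.<⇒≤ s<r) T≅) (≅-neg (flux≅0 (+ i) s s<r)))
    where
    lemma : ∀ p i s → - (+ 2 * (p * i + (+ 1 + s))) + + 2 ≡ - (+ 2 * (p * i + s))
    lemma = solve-∀

  T-next-block : ∀ i → T (suc r) (position i r) ≅ value (+ i) mod p⁸ →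
    T (suc r) (position (suc i) 0) ≅ value (+ suc i) mod p⁸
  T-next-block i T≅ = subst₂ (_≅_mod p⁸)
    (sym (trans (T-step (position (suc i) 0)) (cong₂ (λ z z′ → T (suc r) z + - flux r z′) (lemma₁ (+ r) (+ i)) (lemma₂ p (+ suc i)))))
    (lemma₃ p (+ i) w)
    (≅-+ T≅ (≅-neg (flux-at-multiple (+ suc i))))
    where
    lemma₁ : ∀ r i → - (+ 2 * ((+ 1 + r) * (+ 1 + i) + 0ℤ)) + + 2 ≡ - (+ 2 * ((+ 1 + r) * i + r))
    lemma₁ = solve-∀
    lemma₂ : ∀ p i → - (+ 2 * (p * i + 0ℤ)) ≡ - (+ 2 * (p * i))
    lemma₂ = solve-∀
    lemma₃ : ∀ p i w → p * p * p * p * p * (- (+ 48 * (i * i * (i * i + - + 1))) * w)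
      + - (p * p * p * p * p * (+ 96 * ((+ 1 + i) * (+ 1 + i + - + 1) * (+ 2 * (+ 1 + i) + - + 1)) * w))
      ≡ p * p * p * p * p * (- (+ 48 * ((+ 1 + i) * (+ 1 + i) * ((+ 1 + i) * (+ 1 + i) + - + 1))) * w)
    lemma₃ = solve-∀

  T-at-position : ∀ i s → s ℕ.≤ r → T (suc r) (position i s) ≅ value (+ i) mod p⁸
  T-at-position i s s≤r = T-within-block i s s≤r (start i)
    where
    start : ∀ i → T (suc r) (position i 0) ≅ value (+ i) mod p⁸
    start zero    = ≡⇒≅ (trans (cong (T (suc r)) (lemma₁ p)) (trans (T-zero (suc r)) (lemma₂ p w)))
      where
      lemma₁ : ∀ p → - (+ 2 * (p * 0ℤ + 0ℤ)) ≡ 0ℤ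
      lemma₁ = solve-∀
      lemma₂ : ∀ p w → 0ℤ ≡ p * p * p * p * p * (- (+ 48 * (0ℤ * 0ℤ * (0ℤ * 0ℤ + - + 1))) * w)
      lemma₂ = solve-∀
    start (suc i) = T-next-block i (T-within-block i r ℕ.≤-refl (start i))

  -- For exponent 7 this provides a natural number `i` that approximates -1/2 `p`-adically, with
  -- `2 i + 1 = p⁷`.
  odd-power : ∀ n → ∃[ i ] p ^ n ≡ + 1 + + 2 * + i
  odd-power zero    = 0 , refl
  odd-power (suc n) with odd-power n
  ... | i , eq = i ℕ.+ k ℕ.* (1 ℕ.+ 2 ℕ.* i) ,
    trans (cong (p *_) eq) (trans (lemma (+ k) (+ i)) (cong (λ x → + 1 + + 2 * x) (sym (cast i))))
    where
    lemma : ∀ k i → (+ 1 + (k + k)) * (+ 1 + + 2 * i) ≡ + 1 + + 2 * (i + k * (+ 1 + + 2 * i))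
    lemma = solve-∀
    cast : ∀ i → + (i ℕ.+ k ℕ.* (1 ℕ.+ 2 ℕ.* i)) ≡ + i + + k * (+ 1 + + 2 * + i)
    cast i = cong (λ x → + i + x) (trans (pos-* k _) (cong (λ x → + k * (+ 1 + x)) (pos-* 2 i)))

  -- With p⁷ = 1 + 2 i the position p i + k is 1 - p⁸.
  T-at-one≅9w : ∀ i → p ^ 7 ≡ + 1 + + 2 * + i → T (suc r) 1ℤ ≅ p⁵ * (+ 9 * w) mod p⁸
  T-at-one≅9w i eq = ≅-trans (T-≅ (suc r) one≅) (≅-trans (T-at-position i k (ℕ.m≤m+n k k)) value≅)
    where
    open ≡-Reasoning
    one≅ : 1ℤ ≅ position i k mod p⁸
    one≅ = modulo 1ℤ (begin
      1ℤ                                   ≡⟨ lemma₁ (+ k) (+ i) ⟩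
      position i k + p * (+ 1 + + 2 * + i) ≡⟨ cong (λ q → position i k + p * q) eq ⟨
      position i k + p * p ^ 7             ≡⟨ cong (λ x → position i k + x) (lemma₂ p) ⟩
      position i k + p⁸ * 1ℤ               ∎)
      where
      lemma₁ : ∀ k i → + 1 ≡ - (+ 2 * ((+ 1 + (k + k)) * i + k)) + (+ 1 + (k + k)) * (+ 1 + + 2 * i)
      lemma₁ = solve-∀
      lemma₂ : ∀ p → p * (p * (p * (p * (p * (p * (p * (p * + 1))))))) ≡ p * p * p * p * p * (p * p * p) * + 1
      lemma₂ = solve-∀
    value≅ : value (+ i) ≅ p⁵ * (+ 9 * w) mod p⁸
    -- The polynomial `-48 i² (i² - 1)` has the value 9 at `i = -1/2`. It therefore differs from 9
    -- by a multiple of `2 i + 1 = p⁷`, with cofactor `m i`.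
    value≅ = ≅-scale {m = p³} p⁵ (modulo (p * p * p * p * (m (+ i) * w)) (begin
      - (+ 48 * (+ i * + i * (+ i * + i - + 1))) * w          ≡⟨ lemma₁ (+ i) w ⟩
      + 9 * w + (+ 1 + + 2 * + i) * (m (+ i) * w)             ≡⟨ cong (λ q → + 9 * w + q * (m (+ i) * w)) eq ⟨
      + 9 * w + p ^ 7 * (m (+ i) * w)                         ≡⟨ cong (λ x → + 9 * w + x) (lemma₂ p (m (+ i) * w)) ⟩
      + 9 * w + p³ * (p * p * p * p * (m (+ i) * w))          ∎))
      where
      m : ℤ → ℤ
      m i = (+ 2 * i + - + 1) * (+ 6 + - (+ 3 * (+ 1 + + 2 * i) * (+ 2 * i + - + 1)))
      lemma₁ : ∀ i w → - (+ 48 * (i * i * (i * i + - + 1))) * w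
        ≡ + 9 * w + (+ 1 + + 2 * i) * ((+ 2 * i + - + 1) * (+ 6 + - (+ 3 * (+ 1 + + 2 * i) * (+ 2 * i + - + 1))) * w)
      lemma₁ = solve-∀
      lemma₂ : ∀ p x → p * (p * (p * (p * (p * (p * (p * + 1)))))) * x ≡ p * p * p * (p * p * p * p * x)
      lemma₂ = solve-∀

  unit : ℤ
  unit = a * a * a * (a * a * a) * (u * u * u * (u * u * u) * (H (+ 1) * H (+ 1) * H (+ 1)))

  -- Since `2 r + 1 = 2 p - 1`, the factorial `(2r + 1)!` contains the single multiple `p` of `p`,
  -- and it enters cubed.
  denominator≡ : denominator r ≡ p³ * unit
  denominator≡ = trans (denominator-factorial r)
    (trans (cong (λ c → a * a * a * (a * a * a) * (u * u * u) * (c * c * c))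
        (trans (∏-two-blocks λ i → + suc i) (cong (u * p *_) (∏-cong r λ i _ → lemma₁ p (+ i)))))
      (lemma₂ a u p (H (+ 1))))
    where
    lemma₁ : ∀ p i → + 1 + (p + i) ≡ + 1 + i + p * + 1
    lemma₁ = solve-∀
    lemma₂ : ∀ a u p h → a * a * a * (a * a * a) * (u * u * u) * (u * p * h * (u * p * h) * (u * p * h))
      ≡ p * p * p * (a * a * a * (a * a * a) * (u * u * u * (u * u * u) * (h * h * h)))
    lemma₂ = solve-∀

  unit≅w : unit ≅ w mod p³
  unit≅w = ≅-* (≅-refl {a * a * a * (a * a * a)}) (≅-* (≅-refl {u * u * u * (u * u * u)}) (≅-* (≅-* h h) h))
    where h = H≅u (+ 1)

  w≇0 : ¬ w ≅ 0ℤ mod p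
  w≇0 = *≇0 p-prime (*≇0 p-prime a³ a³) (*≇0 p-prime (*≇0 p-prime u³ u³) u³)
    where
    cube : ∀ {x} → ¬ x ≅ 0ℤ mod p → ¬ x * x * x ≅ 0ℤ mod p
    cube x≇0 = *≇0 p-prime (*≇0 p-prime x≇0 x≇0) x≇0
    a³ : ¬ a * a * a ≅ 0ℤ mod p
    a³ = cube (∏≇0 p-prime r (λ _ → + 2) λ _ _ → small≇0 (ℕ.<-trans (ℕ.n<1+n 2) 3<p))
    u³ : ¬ u * u * u ≅ 0ℤ mod p
    u³ = cube (factorial≇0 k p-prime 3<p)

  unit≇0 : ¬ unit ≅ 0ℤ mod p
  unit≇0 unit≅0 = w≇0 (≅-trans (≅-sym (weaken unit≅w)) unit≅0)
    where
    weaken : ∀ {x y} → x ≅ y mod p³ → x ≅ y mod p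
    weaken {y = y} (modulo q refl) = modulo (p * p * q) (lemma y p q)
      where
      lemma : ∀ y p q → y + p * p * p * q ≡ y + p * (p * p * q)
      lemma = solve-∀

  -- Replacing `w` by `unit`, which agrees with it modulo `p³`, prepares the division by `p³ * unit`
  -- that yields `9 p²`.
  T-at-one≅ : T (suc r) 1ℤ ≅ p⁵ * (+ 9 * unit) mod p⁸
  T-at-one≅ = ≅-trans (T-at-one≅9w (proj₁ (odd-power 7)) (proj₂ (odd-power 7))) (≅-scale {m = p³} p⁵ (≅-* (≅-refl {+ 9}) (≅-sym unit≅w)))

-- The summand at z = 1 in binomial and Pochhammer form.

module Summands where
  open import Defs using (quad)
  open import Data.Integer hiding (suc)
  open import Data.Integer.Properties
  open import Data.Integer.Tactic.RingSolver
  open import Data.Nat.Combinatorics using (_C_; nCk≡n!/k![n-k]!; k![n∸k]!∣n!)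
  import Data.Nat.DivMod as ℕ
  import Data.Nat.Properties as ℕ
  open import Relation.Binary.PropositionalEquality
  open ≡-Reasoning
  open FiniteProduct *-1-commutativeMonoid
  open WilfZeilberger
  open Evaluation

  -- This is `dⁿ (c/d)ₙ`, a Pochhammer symbol with its denominator cleared.
  progression : ℤ → ℤ → ℕ → ℤ
  progression c d n = ∏ n λ i → c + d * + i

  ∏-const : ∀ c n → ∏ n (λ _ → c) ≡ c ^ n
  ∏-const c zero    = refl
  ∏-const c (suc n) = trans (cong (_* c) (∏-const c n)) (*-comm (c ^ n) c)

  ^-distribʳ-* : ∀ c d n → (c * d) ^ n ≡ c ^ n * d ^ n
  ^-distribʳ-* c d zero    = refl
  ^-distribʳ-* c d (suc n) = trans (cong (c * d *_) (^-distribʳ-* c d n)) (lemma c d (c ^ n) (d ^ n))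
    where
    lemma : ∀ c d x y → c * d * (x * y) ≡ c * x * (d * y)
    lemma = solve-∀

  ∏-nonZero : ∀ n {f} → (∀ i → NonZero (f i)) → NonZero (∏ n f)
  ∏-nonZero zero    f≢0 = _
  ∏-nonZero (suc n) {f} f≢0 = i*j≢0 (∏ n f) (f n) {{∏-nonZero n f≢0}} {{f≢0 n}}

  factorial-nonZero : ∀ n → NonZero (factorial n)
  factorial-nonZero n = ∏-nonZero n λ _ → _

  factorial≡! : ∀ n → factorial n ≡ + (n ℕ.!)
  factorial≡! zero    = refl
  factorial≡! (suc n) = trans (cong (_* + suc n) (factorial≡! n))
    (trans (*-comm (+ (n ℕ.!)) (+ suc n)) (sym (pos-* (suc n) (n ℕ.!))))

  binomial-factorial : ∀ m n → + ((m ℕ.+ n) C m) * (factorial m * factorial n) ≡ factorial (m ℕ.+ n)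
  binomial-factorial m n = begin
    + ((m ℕ.+ n) C m) * (factorial m * factorial n)
      ≡⟨ cong₂ (λ x y → + ((m ℕ.+ n) C m) * (x * y)) (factorial≡! m) (factorial≡! n) ⟩
    + ((m ℕ.+ n) C m) * (+ (m ℕ.!) * + (n ℕ.!))
      ≡⟨ cong (+ ((m ℕ.+ n) C m) *_) (pos-* (m ℕ.!) (n ℕ.!)) ⟨
    + ((m ℕ.+ n) C m) * + (m ℕ.! ℕ.* n ℕ.!)
      ≡⟨ pos-* ((m ℕ.+ n) C m) (m ℕ.! ℕ.* n ℕ.!) ⟨
    + (((m ℕ.+ n) C m) ℕ.* (m ℕ.! ℕ.* n ℕ.!))
      ≡⟨ cong +_ natural ⟩
    + ((m ℕ.+ n) ℕ.!)
      ≡⟨ factorial≡! (m ℕ.+ n) ⟨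
    factorial (m ℕ.+ n) ∎
    where
    m≤ = ℕ.m≤m+n m n
    natural : ((m ℕ.+ n) C m) ℕ.* (m ℕ.! ℕ.* n ℕ.!) ≡ (m ℕ.+ n) ℕ.!
    natural = subst (λ k → ((m ℕ.+ n) C m) ℕ.* (m ℕ.! ℕ.* k ℕ.!) ≡ (m ℕ.+ n) ℕ.!) (ℕ.m+n∸m≡n m n)
      (trans (cong (ℕ._* (m ℕ.! ℕ.* (m ℕ.+ n ℕ.∸ m) ℕ.!)) (nCk≡n!/k![n-k]! m≤))
        (ℕ.m/n*n≡m {{ℕ._!*_!≢0 m (m ℕ.+ n ℕ.∸ m)}} (k![n∸k]!∣n! m≤)))

  double : ∀ n → 2 ℕ.* n ≡ n ℕ.+ n
  double n = cong (n ℕ.+_) (ℕ.+-identityʳ n)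

  -- Separates odd from even factors; `rise 1ℤ n` is the double factorial `(2n - 1)!!`.
  factorial-double : ∀ n → factorial (2 ℕ.* n) ≡ twos n * rise 1ℤ n * factorial n
  factorial-double n = begin
    factorial (2 ℕ.* n)                                              ≡⟨ cong factorial (double n) ⟩
    factorial (n ℕ.+ n)                                              ≡⟨ ∏-interleave n _ ⟩
    ∏ n (λ i → + suc (i ℕ.+ i)) * ∏ n (λ i → + suc (suc (i ℕ.+ i)))
      ≡⟨ cong₂ _*_ (∏-cong n λ i _ → lemma₁ (+ i)) (trans (∏-cong n λ i _ → lemma₂ (+ i)) (∏-∙ n (λ _ → + 2) (λ i → + suc i))) ⟩
    rise 1ℤ n * (twos n * factorial n)                               ≡⟨ lemma₃ (rise 1ℤ n) (twos n) (factorial n) ⟩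
    twos n * rise 1ℤ n * factorial n                                 ∎
    where
    lemma₁ : ∀ i → + 1 + (i + i) ≡ + 1 + + 2 * i
    lemma₁ = solve-∀
    lemma₂ : ∀ i → + 2 + (i + i) ≡ + 2 * (+ 1 + i)
    lemma₂ = solve-∀
    lemma₃ : ∀ x y z → x * (y * z) ≡ y * x * z
    lemma₃ = solve-∀

  -- The factors are sorted by residue modulo 3. The classes of 1 and 2 are the source of `(1/3)ₙ`
  -- and `(2/3)ₙ`, and the multiples of 3 give `3ⁿ n!`.
  factorial-triple : ∀ n → factorial (3 ℕ.* n)
    ≡ progression (+ 1) (+ 3) n * progression (+ 2) (+ 3) n * ((+ 3) ^ n * factorial n)
  factorial-triple zero    = refl
  factorial-triple (suc n) = begin
    factorial (3 ℕ.* suc n)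
      ≡⟨ cong factorial (ℕ.*-suc 3 n) ⟩
    factorial (3 ℕ.* n) * + (1 ℕ.+ 3 ℕ.* n) * + (2 ℕ.+ 3 ℕ.* n) * + (3 ℕ.+ 3 ℕ.* n)
      ≡⟨ cong₂ (λ x y → x * (+ 1 + y) * (+ 2 + y) * (+ 3 + y)) (factorial-triple n) (pos-* 3 n) ⟩
    progression (+ 1) (+ 3) n * progression (+ 2) (+ 3) n * ((+ 3) ^ n * factorial n)
      * (+ 1 + + 3 * + n) * (+ 2 + + 3 * + n) * (+ 3 + + 3 * + n)
      ≡⟨ lemma (progression (+ 1) (+ 3) n) (progression (+ 2) (+ 3) n) ((+ 3) ^ n) (factorial n) (+ n) ⟩
    progression (+ 1) (+ 3) (suc n) * progression (+ 2) (+ 3) (suc n) * ((+ 3) ^ suc n * factorial (suc n)) ∎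
    where
    lemma : ∀ a b c d n → a * b * (c * d) * (+ 1 + + 3 * n) * (+ 2 + + 3 * n) * (+ 3 + + 3 * n)
      ≡ a * (+ 1 + + 3 * n) * (b * (+ 2 + + 3 * n)) * (+ 3 * c * (d * (+ 1 + n)))
    lemma = solve-∀

  rise-double : ∀ n → rise 1ℤ (2 ℕ.* n) ≡ progression (+ 1) (+ 4) n * progression (+ 3) (+ 4) n
  rise-double n = trans (cong (rise 1ℤ) (double n)) (trans (∏-interleave n _)
    (cong₂ _*_ (∏-cong n λ i _ → lemma₁ (+ i)) (∏-cong n λ i _ → lemma₂ (+ i))))
    where
    lemma₁ : ∀ i → + 1 + + 2 * (i + i) ≡ + 1 + + 4 * i
    lemma₁ = solve-∀
    lemma₂ : ∀ i → + 1 + + 2 * (+ 1 + (i + i)) ≡ + 3 + + 4 * i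
    lemma₂ = solve-∀

  fall-one : ∀ n → fall 1ℤ n ≡ -1ℤ ^ n * rise 1ℤ n
  fall-one n = trans (∏-cong n λ i _ → lemma (+ i))
    (trans (∏-∙ n (λ _ → -1ℤ) (λ i → 1ℤ + + 2 * + i)) (cong (_* rise 1ℤ n) (∏-const -1ℤ n)))
    where
    lemma : ∀ i → 1ℤ + - (+ 2 * (+ 1 + i)) ≡ -1ℤ * (+ 1 + + 2 * i)
    lemma = solve-∀

  Q-at-one : ∀ n → let l = + 2 * + n + + 1 in Q (+ n) 1ℤ ≡ l * l * l * + quad n
  Q-at-one n = trans (lemma (+ n)) (cong (λ x → (+ 2 * + n + + 1) * (+ 2 * + n + + 1) * (+ 2 * + n + + 1) * x) (sym cast))
    where
    lemma : ∀ n → n * n * (+ 208 + n * (+ 1248 + n * (+ 2400 + n * + 1376)))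
      + + 1 * (n * (+ 96 + n * (+ 576 + n * (+ 984 + n * + 264)))
      + + 1 * (+ 12 + n * (+ 72 + n * (+ 36 + - (n * + 228)))
      + - (+ 1 * (n * (+ 30 + n * + 90) + + 1 * (+ 3 + + 9 * n)))))
      ≡ (+ 2 * n + + 1) * (+ 2 * n + + 1) * (+ 2 * n + + 1) * (+ 172 * (n * (n * + 1)) + + 75 * n + + 9)
    lemma = solve-∀
    cast : + quad n ≡ + 172 * (+ n * (+ n * + 1)) + + 75 * + n + + 9
    cast = cong₂ (λ x y → x + y + + 9)
      (trans (pos-* 172 (n ℕ.^ 2)) (cong (+ 172 *_) (trans (pos-* n (n ℕ.* 1)) (cong (+ n *_) (pos-* n 1)))))
      (pos-* 75 n)

  -- The increment of `T` at `z = 1`. Divided by `denominator n`, it is the summand of the theorem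
  -- in either form.
  summand : ℕ → ℤ
  summand n = kernel n 1ℤ * Q (+ n) 1ℤ

  module _ (n : ℕ) where
    private
      a o f l σ R g F : ℤ
      a = twos n
      o = rise 1ℤ n
      f = factorial n
      l = + 2 * + n + + 1
      σ = -1ℤ ^ n
      R = rise 1ℤ (2 ℕ.* n)
      g = factorial (2 ℕ.* n)
      F = factorial (3 ℕ.* n)

    summand≡ : summand n ≡ o * o * o * R * (σ * o) * F * (l * l * l * + quad n)
    summand≡ = cong₂ (λ x y → o * o * o * R * x * F * y) (fall-one n) (Q-at-one n)

    denominator≡ : denominator n ≡ a * a * a * (a * a * a) * (f * f * f) * (g * l * (g * l) * (g * l))
    denominator≡ = trans (denominator-factorial n) (cong (λ x → a * a * a * (a * a * a) * (f * f * f) * (x * x * x)) last)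
      where
      last : factorial (suc (2 ℕ.* n)) ≡ g * l
      last = cong (g *_) (trans (cong (λ x → + 1 + x) (pos-* 2 n)) (+-comm (+ 1) (+ 2 * + n)))

    binomial-summand : denominator n * (σ * + quad n *
        + (((2 ℕ.* n) C n) ℕ.^ 3 ℕ.* ((3 ℕ.* n) C n) ℕ.* ((4 ℕ.* n) C (2 ℕ.* n))))
      ≡ + (2 ℕ.^ (12 ℕ.* n)) * summand n
    binomial-summand = *-cancelˡ-≡ c _ _ {{c≢0}} (begin
      c * (denominator n * (σ * q * + B))
        ≡⟨ cong₂ (λ x y → c * (x * (σ * q * y))) denominator≡ B≡ ⟩
      c * (a * a * a * (a * a * a) * (f * f * f) * (g * l * (g * l) * (g * l)) * (σ * q * (x * (x * (x * + 1)) * y * z)))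
        ≡⟨ lemma₁ a f g l σ q x y z ⟩
      a * a * a * (a * a * a) * (l * l * l) * (σ * q) * (g * g * g) * (X * X * X) * Y * Z
        ≡⟨ cong₂ (λ s t → a * a * a * (a * a * a) * (l * l * l) * (σ * q) * (g * g * g) * (s * s * s) * Y * t) X≡ Z≡ ⟩
      a * a * a * (a * a * a) * (l * l * l) * (σ * q) * (g * g * g) * (g * g * g) * Y * (a * a * R * g)
        ≡⟨ cong (λ s → a * a * a * (a * a * a) * (l * l * l) * (σ * q) * (g * g * g) * (g * g * g) * s * (a * a * R * g)) Y≡ ⟩
      a * a * a * (a * a * a) * (l * l * l) * (σ * q) * (g * g * g) * (g * g * g) * F * (a * a * R * g)
        ≡⟨ lemma₂ a l (σ * q) g F R ⟩
      g * g * g * g * (a * a * a * (a * a * a) * (a * a)) * (l * l * l) * (σ * q) * (g * g * g) * R * F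
        ≡⟨ cong (λ s → s * s * s * s * (a * a * a * (a * a * a) * (a * a)) * (l * l * l) * (σ * q) * (g * g * g) * R * F)
             (factorial-double n) ⟩
      a * o * f * (a * o * f) * (a * o * f) * (a * o * f) * (a * a * a * (a * a * a) * (a * a)) * (l * l * l) * (σ * q) * (g * g * g) * R * F
        ≡⟨ lemma₃ a l σ q g F R o f ⟩
      c * (a * a * a * (a * a * a) * (a * a * a * (a * a * a)) * (o * o * o * R * (σ * o) * F * (l * l * l * q)))
        ≡⟨ cong₂ (λ s t → c * (s * t)) power≡ (sym summand≡) ⟩
      c * (+ (2 ℕ.^ (12 ℕ.* n)) * summand n) ∎)
      where
      q = + quad n
      -- Clearing the five binomial coefficients takes `n!⁷ (2n)!³`, and `denominator n` already
      -- supplies `n!³`.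
      c = f * f * f * f * (g * g * g)
      B = ((2 ℕ.* n) C n) ℕ.^ 3 ℕ.* ((3 ℕ.* n) C n) ℕ.* ((4 ℕ.* n) C (2 ℕ.* n))
      x = + ((2 ℕ.* n) C n)
      y = + ((3 ℕ.* n) C n)
      z = + ((4 ℕ.* n) C (2 ℕ.* n))
      X = x * (f * f)
      Y = y * (f * g)
      Z = z * (g * g)

      c≢0 : NonZero c
      c≢0 = i*j≢0 (f * f * f * f) (g * g * g) {{i*j≢0 (f * f * f) f {{i*j≢0 (f * f) f {{i*j≢0 f f}}}}}} {{i*j≢0 (g * g) g {{i*j≢0 g g}}}}
        where
        instance
          f≢0 : NonZero f
          f≢0 = factorial-nonZero n
          g≢0 : NonZero g
          g≢0 = factorial-nonZero (2 ℕ.* n)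

      B≡ : + B ≡ x * (x * (x * + 1)) * y * z
      B≡ = trans (pos-* (b ℕ.^ 3 ℕ.* ((3 ℕ.* n) C n)) _) (cong (_* z) (trans (pos-* (b ℕ.^ 3) _) (cong (_* y)
        (trans (pos-* b _) (cong (x *_) (trans (pos-* b _) (cong (x *_) (pos-* b 1))))))))
        where b = (2 ℕ.* n) C n

      X≡ : X ≡ g
      X≡ = subst (λ m → + (m C n) * (f * f) ≡ factorial m) (sym (double n)) (binomial-factorial n n)

      Y≡ : Y ≡ F
      Y≡ = binomial-factorial n (2 ℕ.* n)

      4n≡ : 4 ℕ.* n ≡ 2 ℕ.* n ℕ.+ 2 ℕ.* n
      4n≡ = ℕ.*-distribʳ-+ n 2 2

      Z≡ : Z ≡ a * a * R * g
      Z≡ = begin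
        Z ≡⟨ subst (λ m → + (m C (2 ℕ.* n)) * (g * g) ≡ factorial m) (sym 4n≡) (binomial-factorial (2 ℕ.* n) (2 ℕ.* n)) ⟩
        factorial (4 ℕ.* n) ≡⟨ cong factorial (trans 4n≡ (sym (double (2 ℕ.* n)))) ⟩
        factorial (2 ℕ.* (2 ℕ.* n)) ≡⟨ factorial-double (2 ℕ.* n) ⟩
        twos (2 ℕ.* n) * R * g ≡⟨ cong (λ t → t * R * g) (trans (cong twos (double n)) (∏-+ n n _)) ⟩
        a * a * R * g ∎

      power≡ : a * a * a * (a * a * a) * (a * a * a * (a * a * a)) ≡ + (2 ℕ.^ (12 ℕ.* n))
      power≡ = sym (begin
        + (2 ℕ.^ (12 ℕ.* n))              ≡⟨ pos-^ (12 ℕ.* n) ⟩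
        (+ 2) ^ (12 ℕ.* n)                ≡⟨ cong ((+ 2) ^_) (ℕ.*-comm 12 n) ⟩
        (+ 2) ^ (n ℕ.* 12)                ≡⟨ ^-*-assoc (+ 2) n 12 ⟨
        ((+ 2) ^ n) ^ 12                  ≡⟨ cong (_^ 12) (∏-const (+ 2) n) ⟨
        a ^ 12                            ≡⟨ lemma a ⟩
        a * a * a * (a * a * a) * (a * a * a * (a * a * a)) ∎)
        where
        pos-^ : ∀ m → + (2 ℕ.^ m) ≡ (+ 2) ^ m
        pos-^ zero    = refl
        pos-^ (suc m) = trans (pos-* 2 (2 ℕ.^ m)) (cong (+ 2 *_) (pos-^ m))
        lemma : ∀ a → a * (a * (a * (a * (a * (a * (a * (a * (a * (a * (a * (a * + 1)))))))))))
          ≡ a * a * a * (a * a * a) * (a * a * a * (a * a * a))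
        lemma = solve-∀

      lemma₁ : ∀ a f g l σ q x y z →
        f * f * f * f * (g * g * g) * (a * a * a * (a * a * a) * (f * f * f) * (g * l * (g * l) * (g * l)) * (σ * q * (x * (x * (x * + 1)) * y * z)))
        ≡ a * a * a * (a * a * a) * (l * l * l) * (σ * q) * (g * g * g) * (x * (f * f) * (x * (f * f)) * (x * (f * f))) * (y * (f * g)) * (z * (g * g))
      lemma₁ = solve-∀
      lemma₂ : ∀ a l s g F R →
        a * a * a * (a * a * a) * (l * l * l) * s * (g * g * g) * (g * g * g) * F * (a * a * R * g)
        ≡ g * g * g * g * (a * a * a * (a * a * a) * (a * a)) * (l * l * l) * s * (g * g * g) * R * F
      lemma₂ = solve-∀
      lemma₃ : ∀ a l σ q g F R o f →
        a * o * f * (a * o * f) * (a * o * f) * (a * o * f) * (a * a * a * (a * a * a) * (a * a)) * (l * l * l) * (σ * q) * (g * g * g) * R * F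
        ≡ f * f * f * f * (g * g * g) * (a * a * a * (a * a * a) * (a * a * a * (a * a * a)) * (o * o * o * R * (σ * o) * F * (l * l * l * q)))
      lemma₃ = solve-∀

    -- The denominators of the five Pochhammer symbols, then that of `(27/16)ⁿ`, then `n!⁵`.
    cleared : ℤ
    cleared = a * ((+ 3) ^ n * (+ 3) ^ n) * ((+ 4) ^ n * (+ 4) ^ n) * (+ 16) ^ n * (f * f * f * f * f)

    pochhammer-summand : denominator n * (o * progression (+ 1) (+ 3) n * progression (+ 2) (+ 3) n
        * progression (+ 1) (+ 4) n * progression (+ 3) (+ 4) n * σ * + quad n * (+ 27) ^ n)
      ≡ cleared * summand n
    pochhammer-summand = begin
      denominator n * (o * t₁ * t₂ * q₁ * q₃ * σ * q * (+ 27) ^ n)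
        ≡⟨ cong₂ (λ x y → x * (o * t₁ * t₂ * q₁ * q₃ * σ * q * y)) denominator≡ 27≡ ⟩
      a * a * a * (a * a * a) * (f * f * f) * (g * l * (g * l) * (g * l)) * (o * t₁ * t₂ * q₁ * q₃ * σ * q * (h * h * h))
        ≡⟨ cong (λ x → a * a * a * (a * a * a) * (f * f * f) * (x * l * (x * l) * (x * l)) * (o * t₁ * t₂ * q₁ * q₃ * σ * q * (h * h * h)))
             (factorial-double n) ⟩
      _
        ≡⟨ lemma a f o l t₁ t₂ q₁ q₃ σ q h ⟩
      a * (h * h) * (a * a * (a * a)) * (a * a * (a * a)) * (f * f * f * f * f)
        * (o * o * o * (q₁ * q₃) * (σ * o) * (t₁ * t₂ * (h * f)) * (l * l * l * q))
        ≡⟨ cong₂ (λ x y → a * (h * h) * (x * x) * y * (f * f * f * f * f)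
             * (o * o * o * (q₁ * q₃) * (σ * o) * (t₁ * t₂ * (h * f)) * (l * l * l * q))) (sym 4≡) (sym 16≡) ⟩
      cleared * (o * o * o * (q₁ * q₃) * (σ * o) * (t₁ * t₂ * (h * f)) * (l * l * l * q))
        ≡⟨ cong₂ (λ x y → cleared * (o * o * o * x * (σ * o) * y * (l * l * l * q))) (sym (rise-double n)) (sym (factorial-triple n)) ⟩
      cleared * (o * o * o * R * (σ * o) * F * (l * l * l * q))
        ≡⟨ cong (cleared *_) summand≡ ⟨
      cleared * summand n ∎
      where
      h = (+ 3) ^ n
      q = + quad n
      t₁ = progression (+ 1) (+ 3) n
      t₂ = progression (+ 2) (+ 3) n
      q₁ = progression (+ 1) (+ 4) n
      q₃ = progression (+ 3) (+ 4) n
      4≡ : (+ 4) ^ n ≡ a * a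
      4≡ = trans (^-distribʳ-* (+ 2) (+ 2) n) (sym (cong₂ _*_ (∏-const (+ 2) n) (∏-const (+ 2) n)))
      16≡ : (+ 16) ^ n ≡ a * a * (a * a)
      16≡ = trans (^-distribʳ-* (+ 4) (+ 4) n) (cong₂ _*_ 4≡ 4≡)
      27≡ : (+ 27) ^ n ≡ h * h * h
      27≡ = trans (^-distribʳ-* (+ 9) (+ 3) n) (cong (_* h) (^-distribʳ-* (+ 3) (+ 3) n))
      lemma : ∀ a f o l t₁ t₂ q₁ q₃ σ q h →
        a * a * a * (a * a * a) * (f * f * f) * (a * o * f * l * (a * o * f * l) * (a * o * f * l)) * (o * t₁ * t₂ * q₁ * q₃ * σ * q * (h * h * h))
        ≡ a * (h * h) * (a * a * (a * a)) * (a * a * (a * a)) * (f * f * f * f * f)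
          * (o * o * o * (q₁ * q₃) * (σ * o) * (t₁ * t₂ * (h * f)) * (l * l * l * q))
      lemma = solve-∀

-- Passage from integers to rationals and p-integrality.

module RationalSums where
  open import Defs

  open import Data.Integer as ℤ using (ℤ; +_; -1ℤ)
  import Data.Integer.Properties as ℤ
  import Data.Integer.Tactic.RingSolver as ℤ-Solver
  open import Data.Nat.Combinatorics using (_C_)
  import Data.Nat.Coprimality as ℕ
  import Data.Nat.Divisibility as ℕ
  import Data.Nat.Properties as ℕ
  open import Data.Nat.Primality using (prime⇒irreducible; prime⇒nonZero; prime⇒nonTrivial)
  open import Data.Product using (_,_)
  open import Data.Rational hiding (_≤_)
  open import Data.Rational.Properties
  open import Algebra.Definitions.RawSemiring +-*-rawSemiring using (_^_)
  open import Data.Rational.Unnormalised as ℚᵘ using (mkℚᵘ; *≡*)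
  import Data.Rational.Unnormalised.Properties as ℚᵘ
  open import Data.Sum using (inj₁; inj₂)
  open import Relation.Binary.PropositionalEquality
  open import Relation.Nullary using (¬_; contradiction)
  open import Algebra.Solver.CommutativeMonoid *-1-commutativeMonoid using (solve; id; _⊜_) renaming (_⊕_ to infixl 5 _⊕_)
  open import Algebra.Properties.CommutativeSemigroup (CommutativeMonoid.commutativeSemigroup *-1-commutativeMonoid) using (interchange)
  open FiniteProduct ℤ.*-1-commutativeMonoid using (∏)
  open Congruence using (_≅_mod_; modulo)
  open PrimeModulus using (∣⇒≅0; small≇0)
  open WilfZeilberger
  open Evaluation
  open Summands

  ι : ℤ → ℚ
  ι i = i / 1

  ι≡mkℚ : ∀ i → ι i ≡ mkℚ i 0 (ℕ.sym (ℕ.1-coprimeTo _))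
  ι≡mkℚ i = ↥p/↧p≡p (mkℚ i 0 _)

  ι-+ : ∀ i j → ι (i ℤ.+ j) ≡ ι i + ι j
  ι-+ i j = sym (trans (cong₂ _+_ (ι≡mkℚ i) (ι≡mkℚ j))
    (cong (_/ 1) (cong₂ ℤ._+_ (ℤ.*-identityʳ i) (ℤ.*-identityʳ j))))

  ι-* : ∀ i j → ι (i ℤ.* j) ≡ ι i * ι j
  ι-* i j = sym (cong₂ _*_ (ι≡mkℚ i) (ι≡mkℚ j))

  ι-^ : ∀ i n → ι (i ℤ.^ n) ≡ ι i ^ n
  ι-^ i zero    = refl
  ι-^ i (suc n) = trans (ι-* i (i ℤ.^ n)) (cong (ι i *_) (ι-^ i n))

  ι-cancelˡ : ∀ v .{{_ : ℤ.NonZero v}} {x y} → ι v * x ≡ ι v * y → x ≡ y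
  ι-cancelˡ v {x} {y} eq = trans (sym (undo x)) (trans (cong (1/ V *_) eq′) (undo y))
    where
    -- The normal form of `ι v` is written out so that its numerator can be read off.
    V = mkℚ v 0 (ℕ.sym (ℕ.1-coprimeTo _))
    instance
      V≢0 : NonZero V
      V≢0 = ≢-nonZero {V} λ V≡0 → ℕ.≢-nonZero⁻¹ ℤ.∣ v ∣ (cong (λ q → ℤ.∣ ↥ q ∣) V≡0)
    eq′ : V * x ≡ V * y
    eq′ = subst (λ z → z * x ≡ z * y) (ι≡mkℚ v) eq
    undo : ∀ z → 1/ V * (V * z) ≡ z
    undo z = trans (sym (*-assoc (1/ V) V z)) (trans (cong (_* z) (*-inverseˡ V)) (*-identityˡ z))

  ι-*-/ : ∀ i d .{{_ : ℕ.NonZero d}} → ι (+ d) * (i / d) ≡ ι i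
  ι-*-/ i d@(suc d-1) = toℚᵘ-injective (begin
    toℚᵘ (ι (+ d) * (i / d))                ≈⟨ toℚᵘ-homo-* (ι (+ d)) (i / d) ⟩
    toℚᵘ (ι (+ d)) ℚᵘ.* toℚᵘ (i / d)        ≈⟨ ℚᵘ.*-cong (toℚᵘ-fromℚᵘ (mkℚᵘ (+ d) 0)) (toℚᵘ-fromℚᵘ (mkℚᵘ i d-1)) ⟩
    mkℚᵘ (+ d) 0 ℚᵘ.* mkℚᵘ i d-1            ≈⟨ *≡* (lemma (+ d) i) ⟩
    mkℚᵘ i 0                                ≈⟨ toℚᵘ-fromℚᵘ (mkℚᵘ i 0) ⟨
    toℚᵘ (ι i)                              ∎)
    where
    open ℚᵘ.≃-Reasoning
    lemma : ∀ d i → d ℤ.* i ℤ.* + 1 ≡ i ℤ.* (+ 1 ℤ.* d)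
    lemma = ℤ-Solver.solve-∀

  ι-^-*-/^ : ∀ i d .{{_ : ℕ.NonZero d}} n → ι ((+ d) ℤ.^ n) * (i / d) ^ n ≡ ι (i ℤ.^ n)
  ι-^-*-/^ i d zero    = refl
  ι-^-*-/^ i d (suc n) = begin
    ι (+ d ℤ.* e) * (x * y)            ≡⟨ cong (_* (x * y)) (ι-* (+ d) e) ⟩
    ι (+ d) * ι e * (x * y)            ≡⟨ interchange (ι (+ d)) (ι e) x y ⟩
    ι (+ d) * x * (ι e * y)            ≡⟨ cong₂ _*_ (ι-*-/ i d) (ι-^-*-/^ i d n) ⟩
    ι i * ι (i ℤ.^ n)                  ≡⟨ ι-* i (i ℤ.^ n) ⟨
    ι (i ℤ.^ suc n)                    ∎
    where
    open ≡-Reasoning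
    e = (+ d) ℤ.^ n
    x = i / d
    y = x ^ n

  ⟨⟩-progression : ∀ c d .{{_ : ℕ.NonZero d}} n → ι ((+ d) ℤ.^ n) * ⟨ c / d ⟩ n ≡ ι (progression c (+ d) n)
  ⟨⟩-progression c d zero    = refl
  ⟨⟩-progression c d (suc n) = begin
    ι (+ d ℤ.* e) * (y * (x + ι (+ n)))               ≡⟨ cong (_* (y * (x + ι (+ n)))) (trans (ι-* (+ d) e) (*-comm (ι (+ d)) (ι e))) ⟩
    ι e * ι (+ d) * (y * (x + ι (+ n)))               ≡⟨ interchange (ι e) (ι (+ d)) y (x + ι (+ n)) ⟩
    ι e * y * (ι (+ d) * (x + ι (+ n)))               ≡⟨ cong (ι e * y *_) (*-distribˡ-+ (ι (+ d)) x (ι (+ n))) ⟩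
    ι e * y * (ι (+ d) * x + ι (+ d) * ι (+ n))       ≡⟨ cong₂ _*_ (⟨⟩-progression c d n) (cong₂ _+_ (ι-*-/ c d) (sym (ι-* (+ d) (+ n)))) ⟩
    ι (progression c (+ d) n) * (ι c + ι (+ d ℤ.* + n)) ≡⟨ cong (ι (progression c (+ d) n) *_) (ι-+ c (+ d ℤ.* + n)) ⟨
    ι (progression c (+ d) n) * ι (c ℤ.+ + d ℤ.* + n) ≡⟨ ι-* (progression c (+ d) n) (c ℤ.+ + d ℤ.* + n) ⟨
    ι (progression c (+ d) (suc n))                   ∎
    where
    open ≡-Reasoning
    e = (+ d) ℤ.^ n
    x = c / d
    y = ⟨ x ⟩ n

  ⟨1⟩-factorial : ∀ n → ⟨ 1ℚ ⟩ n ≡ ι (factorial n)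
  ⟨1⟩-factorial zero    = refl
  ⟨1⟩-factorial (suc n) = trans (cong₂ _*_ (⟨1⟩-factorial n) (sym (ι-+ (+ 1) (+ n)))) (sym (ι-* (factorial n) (+ suc n)))

  -- Reduces a claim about a rational `x` with denominator `v` to an identity between integers:
  -- multiply by `v` and cancel.
  clear : ∀ v .{{_ : ℤ.NonZero v}} D {w j x} → ι v * x ≡ ι w → D ℤ.* w ≡ v ℤ.* j → ι D * x ≡ ι j
  clear v D {w} {j} {x} vx≡w Dw≡vj = ι-cancelˡ v (begin
    ι v * (ι D * x)    ≡⟨ solve 3 (λ v D x → v ⊕ (D ⊕ x) ⊜ D ⊕ (v ⊕ x)) refl (ι v) (ι D) x ⟩
    ι D * (ι v * x)    ≡⟨ cong (ι D *_) vx≡w ⟩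
    ι D * ι w          ≡⟨ ι-* D w ⟨
    ι (D ℤ.* w)        ≡⟨ cong ι Dw≡vj ⟩
    ι (v ℤ.* j)        ≡⟨ ι-* v j ⟩
    ι v * ι j          ∎)
    where open ≡-Reasoning

  binomialTerm-cleared : ∀ n → ι (denominator n) * binomialTerm n ≡ ι (summand n)
  binomialTerm-cleared n = clear (+ d) {{d≢0}} (denominator n) (begin
    ι (+ d) * (_/_ s d {{d≢0}} * ι (+ B))    ≡⟨ *-assoc (ι (+ d)) (_/_ s d {{d≢0}}) (ι (+ B)) ⟨
    ι (+ d) * _/_ s d {{d≢0}} * ι (+ B)      ≡⟨ cong (_* ι (+ B)) (ι-*-/ s d {{d≢0}}) ⟩
    ι s * ι (+ B)                            ≡⟨ ι-* s (+ B) ⟨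
    ι (s ℤ.* + B)                            ∎)
    (binomial-summand n)
    where
    open ≡-Reasoning
    d = 2 ℕ.^ (12 ℕ.* n)
    d≢0 = ℕ.m^n≢0 2 (12 ℕ.* n)
    s = -1ℤ ℤ.^ n ℤ.* + quad n
    B = ((2 ℕ.* n) C n) ℕ.^ 3 ℕ.* ((3 ℕ.* n) C n) ℕ.* ((4 ℕ.* n) C (2 ℕ.* n))

  cleared-nonZero : ∀ n → ℤ.NonZero (cleared n)
  cleared-nonZero n = ℤ.≢-nonZero
    (≢0 {twos n} (∏-nonZero n (λ _ → _)) ⊠ (power (+ 3) ⊠ power (+ 3)) ⊠ (power (+ 4) ⊠ power (+ 4)) ⊠ power (+ 16) ⊠ (f ⊠ f ⊠ f ⊠ f ⊠ f))
    where
    ≢0 : ∀ {i} → ℤ.NonZero i → i ≢ + 0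
    ≢0 i≢0 refl = ℕ.≢-nonZero⁻¹ 0 {{i≢0}} refl
    infixl 7 _⊠_
    _⊠_ : ∀ {i j} → i ≢ + 0 → j ≢ + 0 → i ℤ.* j ≢ + 0
    _⊠_ {i} i≢0 j≢0 ij≡0 with ℤ.i*j≡0⇒i≡0∨j≡0 i ij≡0
    ... | inj₁ i≡0 = i≢0 i≡0
    ... | inj₂ j≡0 = j≢0 j≡0
    power : ∀ c {{_ : ℤ.NonZero c}} → c ℤ.^ n ≢ + 0
    power c {{c≢0}} = subst (_≢ + 0) (∏-const c n) (≢0 {∏ n (λ _ → c)} (∏-nonZero n λ _ → c≢0))
    f : factorial n ≢ + 0
    f = ≢0 {factorial n} (factorial-nonZero n)

  -- Pairs a left-nested product of values of `ι` with its integer value, so that a long product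
  -- collapses into a single `ι` by a chain of `_⊡_`.
  record _IsInteger_ (x : ℚ) (i : ℤ) : Set where
    constructor isInteger
    field
      equality : x ≡ ι i

  open _IsInteger_

  integer : ∀ i → ι i IsInteger i
  integer i = isInteger refl

  infixl 6 _⊡_
  _⊡_ : ∀ {x i} → x IsInteger i → ∀ j → (x * ι j) IsInteger (i ℤ.* j)
  _⊡_ {i = i} (isInteger eq) j = isInteger (trans (cong (_* ι j) eq) (sym (ι-* i j)))

  pochhammerTerm-cleared : ∀ n → ι (denominator n) * pochhammerTerm n ≡ ι (summand n)
  pochhammerTerm-cleared n = clear (cleared n) {{cleared-nonZero n}} (denominator n) (begin
    ι (cleared n) * pochhammerTerm n
      ≡⟨ cong (_* pochhammerTerm n) cleared≡ ⟩
    A * (B * B) * (K * K) * G * Y * (h * t₁ * t₂ * q₁ * q₃ * Y⁻¹ * s * c * e)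
      -- Each Pochhammer symbol is paired with its power of 2, 3 or 4, `e` with `16ⁿ`, and `Y⁻¹`
      -- with `Y`. Every pair is then an integer.
      ≡⟨ solve 14 (λ A B K G Y h t₁ t₂ q₁ q₃ Y⁻¹ s c e →
           A ⊕ (B ⊕ B) ⊕ (K ⊕ K) ⊕ G ⊕ Y ⊕ (h ⊕ t₁ ⊕ t₂ ⊕ q₁ ⊕ q₃ ⊕ Y⁻¹ ⊕ s ⊕ c ⊕ e)
           ⊜ (A ⊕ h) ⊕ (B ⊕ t₁) ⊕ (B ⊕ t₂) ⊕ (K ⊕ q₁) ⊕ (K ⊕ q₃) ⊕ s ⊕ c ⊕ (G ⊕ e) ⊕ (Y ⊕ Y⁻¹))
           refl A B K G Y h t₁ t₂ q₁ q₃ Y⁻¹ s c e ⟩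
    A * h * (B * t₁) * (B * t₂) * (K * q₁) * (K * q₃) * s * c * (G * e) * (Y * Y⁻¹)
      ≡⟨ cong₂ _*_ (cong₂ _*_ (cong (_* c) (cong₂ _*_ (cong₂ _*_ (cong₂ _*_ (cong₂ _*_ (cong₂ _*_
           (trans (cong (λ x → ι x * h) (∏-const (+ 2) n)) (⟨⟩-progression (+ 1) 2 n))
           (⟨⟩-progression (+ 1) 3 n)) (⟨⟩-progression (+ 2) 3 n)) (⟨⟩-progression (+ 1) 4 n)) (⟨⟩-progression (+ 3) 4 n))
           (sym (ι-^ -1ℤ n)))) (ι-^-*-/^ (+ 27) 16 n)) (*-inverseʳ Y {{⟨1⟩^5≢0 n}}) ⟩
    ι o * ι T₁ * ι T₂ * ι Q₁ * ι Q₃ * ι (-1ℤ ℤ.^ n) * ι (+ quad n) * ι ((+ 27) ℤ.^ n) * 1ℚ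
      ≡⟨ *-identityʳ _ ⟩
    ι o * ι T₁ * ι T₂ * ι Q₁ * ι Q₃ * ι (-1ℤ ℤ.^ n) * ι (+ quad n) * ι ((+ 27) ℤ.^ n)
      ≡⟨ equality (integer o ⊡ T₁ ⊡ T₂ ⊡ Q₁ ⊡ Q₃ ⊡ -1ℤ ℤ.^ n ⊡ + quad n ⊡ (+ 27) ℤ.^ n) ⟩
    ι (o ℤ.* T₁ ℤ.* T₂ ℤ.* Q₁ ℤ.* Q₃ ℤ.* -1ℤ ℤ.^ n ℤ.* + quad n ℤ.* (+ 27) ℤ.^ n) ∎)
    (pochhammer-summand n)
    where
    open ≡-Reasoning
    o = rise (+ 1) n
    T₁ = progression (+ 1) (+ 3) n
    T₂ = progression (+ 2) (+ 3) n
    Q₁ = progression (+ 1) (+ 4) n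
    Q₃ = progression (+ 3) (+ 4) n
    A = ι (twos n)
    B = ι ((+ 3) ℤ.^ n)
    K = ι ((+ 4) ℤ.^ n)
    G = ι ((+ 16) ℤ.^ n)
    Y = (⟨ 1ℚ ⟩ n) ^ 5
    h = ⟨ ½ ⟩ n
    t₁ = ⟨ + 1 / 3 ⟩ n
    t₂ = ⟨ + 2 / 3 ⟩ n
    q₁ = ⟨ + 1 / 4 ⟩ n
    q₃ = ⟨ + 3 / 4 ⟩ n
    Y⁻¹ = (1/ Y) {{⟨1⟩^5≢0 n}}
    s = (- 1ℚ) ^ n
    c = fromℕ (quad n)
    e = (+ 27 / 16) ^ n
    f = factorial n
    Y≡ : ι (f ℤ.* f ℤ.* f ℤ.* f ℤ.* f) ≡ Y
    Y≡ = trans (sym (equality (integer f ⊡ f ⊡ f ⊡ f ⊡ f))) (trans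
      (solve 1 (λ y → y ⊕ y ⊕ y ⊕ y ⊕ y ⊜ y ⊕ (y ⊕ (y ⊕ (y ⊕ (y ⊕ id))))) refl (ι f))
      (cong (_^ 5) (sym (⟨1⟩-factorial n))))
    cleared≡ : ι (cleared n) ≡ A * (B * B) * (K * K) * G * Y
    cleared≡ = trans (sym (equality (integer (twos n) ⊡ b ℤ.* b ⊡ k ℤ.* k ⊡ (+ 16) ℤ.^ n ⊡ f ℤ.* f ℤ.* f ℤ.* f ℤ.* f)))
      (cong₂ _*_ (cong₂ (λ x y → A * x * y * G) (ι-* b b) (ι-* k k)) Y≡)
      where
      b = (+ 3) ℤ.^ n
      k = (+ 4) ℤ.^ n

  -- The recursion of `T` is that of the partial sums multiplied by their denominators. All that
  -- enters about `term` is `cleared`, so both forms of the sum are treated together.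
  ∑-cleared : ∀ term → (∀ n → ι (denominator n) * term n ≡ ι (summand n)) →
    ∀ r → ι (denominator r) * ∑< (suc r) term ≡ ι (T (suc r) (+ 1))
  ∑-cleared term cleared zero    = trans (cong (ι (denominator 0) *_) (+-identityˡ (term 0))) (cleared 0)
  ∑-cleared term cleared (suc r) = begin
    ι (denominator (suc r)) * (∑< (suc r) term + term (suc r))
      ≡⟨ *-distribˡ-+ (ι (denominator (suc r))) (∑< (suc r) term) (term (suc r)) ⟩
    ι (G ℤ.* denominator r) * ∑< (suc r) term + ι (denominator (suc r)) * term (suc r)
      ≡⟨ cong₂ _+_ (cong (_* ∑< (suc r) term) (ι-* G (denominator r))) (cleared (suc r)) ⟩
    ι G * ι (denominator r) * ∑< (suc r) term + ι (summand (suc r))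
      ≡⟨ cong (_+ ι (summand (suc r))) (*-assoc (ι G) (ι (denominator r)) (∑< (suc r) term)) ⟩
    ι G * (ι (denominator r) * ∑< (suc r) term) + ι (summand (suc r))
      ≡⟨ cong (λ x → ι G * x + ι (summand (suc r))) (∑-cleared term cleared r) ⟩
    ι G * ι (T (suc r) (+ 1)) + ι (summand (suc r))
      ≡⟨ cong (_+ ι (summand (suc r))) (ι-* G (T (suc r) (+ 1))) ⟨
    ι (G ℤ.* T (suc r) (+ 1)) + ι (summand (suc r))
      ≡⟨ ι-+ (G ℤ.* T (suc r) (+ 1)) (summand (suc r)) ⟨
    ι (T (suc (suc r)) (+ 1)) ∎
    where
    open ≡-Reasoning
    G = growth (+ suc r)

  -- With `x = n / d` in lowest terms, `u n = i d` forces `d` to divide `u`. A common divisor of `d`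
  -- and `p` other than 1 would be `p`, which does not divide `u`.
  integral : ∀ {p} → Prime p → ∀ u x i → ¬ u ≅ + 0 mod + p → ι u * x ≡ ι i → Integral p x
  integral {p} p-prime u x@(mkℚ n d-1 n⊥d) i u≇0 ux≡i {e} (e∣d , e∣p) with prime⇒irreducible p-prime e∣p
  ... | inj₁ e≡1  = e≡1
  ... | inj₂ refl = contradiction (∣⇒≅0 (ℕ.∣-trans e∣d d∣u)) u≇0
    where
    d = suc d-1
    cross : mkℚᵘ u 0 ℚᵘ.* mkℚᵘ n d-1 ℚᵘ.≃ mkℚᵘ i 0
    cross = begin
      mkℚᵘ u 0 ℚᵘ.* mkℚᵘ n d-1  ≈⟨ ℚᵘ.*-congʳ (toℚᵘ-fromℚᵘ (mkℚᵘ u 0)) ⟨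
      toℚᵘ (ι u) ℚᵘ.* toℚᵘ x    ≈⟨ toℚᵘ-homo-* (ι u) x ⟨
      toℚᵘ (ι u * x)            ≈⟨ toℚᵘ-cong ux≡i ⟩
      toℚᵘ (ι i)                ≈⟨ toℚᵘ-fromℚᵘ (mkℚᵘ i 0) ⟩
      mkℚᵘ i 0                  ∎
      where open ℚᵘ.≃-Reasoning
    d∣u : d ℕ.∣ ℤ.∣ u ∣
    d∣u with cross
    ... | *≡* eq = ℕ.coprime-divisor (ℕ.sym (ℕ.recompute n⊥d)) (ℕ.divides ℤ.∣ i ∣ (begin
      ℤ.∣ n ∣ ℕ.* ℤ.∣ u ∣                 ≡⟨ ℤ.abs-* n u ⟨
      ℤ.∣ n ℤ.* u ∣                       ≡⟨ cong ℤ.∣_∣ (trans (ℤ.*-comm n u) (sym (ℤ.*-identityʳ (u ℤ.* n)))) ⟩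
      ℤ.∣ u ℤ.* n ℤ.* + 1 ∣               ≡⟨ cong ℤ.∣_∣ eq ⟩
      ℤ.∣ i ℤ.* (+ 1 ℤ.* + d) ∣           ≡⟨ cong (λ k → ℤ.∣ i ℤ.* k ∣) (ℤ.*-identityˡ (+ d)) ⟩
      ℤ.∣ i ℤ.* + d ∣                     ≡⟨ ℤ.abs-* i (+ d) ⟩
      ℤ.∣ i ∣ ℕ.* d                       ∎))
      where open ≡-Reasoning

  ι-neg : ∀ i → ι (ℤ.- i) ≡ - ι i
  ι-neg i = begin
    ι (ℤ.- i)          ≡⟨ cong ι (ℤ.-1*i≡-i i) ⟨
    ι (-1ℤ ℤ.* i)      ≡⟨ ι-* -1ℤ i ⟩
    - 1ℚ * ι i         ≡⟨ neg-distribˡ-* 1ℚ (ι i) ⟨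
    - (1ℚ * ι i)       ≡⟨ cong -_ (*-identityˡ (ι i)) ⟩
    - ι i              ∎
    where open ≡-Reasoning

  -- Dividing by `p³` gives `u x = 9 p² u + p⁵ k`. Hence `(x - 9 p²) / p⁵ = k / u`, and this is
  -- `p`-integral because `p` does not divide `u`.
  congruence-from-cleared : ∀ {p} → Prime p → ∀ D u t x →
    D ≡ + p ℤ.* + p ℤ.* + p ℤ.* u →
    t ≅ + p ℤ.* + p ℤ.* + p ℤ.* + p ℤ.* + p ℤ.* (+ 9 ℤ.* u)
      mod (+ p ℤ.* + p ℤ.* + p ℤ.* + p ℤ.* + p ℤ.* (+ p ℤ.* + p ℤ.* + p)) →
    ¬ u ≅ + 0 mod + p →
    ι D * x ≡ ι t → x ≡ fromℕ (9 ℕ.* p ℕ.^ 2) [mod p ℕ.^ 5 ]⟨ p ⟩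
  congruence-from-cleared {p} p-prime D u t x D≡ (modulo k t≡) u≇0 Dx≡t =
    integral p-prime u x w u≇0 ux≡ , integral p-prime (+ 1) y Y 1≇0 (*-identityˡ y) , z , integral p-prime u z k u≇0 uz≡k , sym mz≡
    where
    open ≡-Reasoning
    P m Y : ℤ
    P = + p
    m = + (p ℕ.^ 5)
    Y = + (9 ℕ.* p ℕ.^ 2)
    y = ι Y
    instance
      p≢0 : ℕ.NonZero p
      p≢0 = prime⇒nonZero p-prime
      m≢0 : ℕ.NonZero (p ℕ.^ 5)
      m≢0 = ℕ.m^n≢0 p 5
    w : ℤ
    w = P ℤ.* P ℤ.* (+ 9 ℤ.* u) ℤ.+ P ℤ.* P ℤ.* P ℤ.* P ℤ.* P ℤ.* k
    z = (x - y) * (+ 1 / p ℕ.^ 5)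

    1≇0 : ¬ + 1 ≅ + 0 mod + p
    1≇0 = small≇0 (ℕ.nonTrivial⇒n>1 p {{prime⇒nonTrivial p-prime}})

    m≡ : m ≡ P ℤ.* (P ℤ.* (P ℤ.* (P ℤ.* (P ℤ.* + 1))))
    m≡ = cast (cast (cast (cast (ℤ.pos-* p 1))))
      where
      cast : ∀ {n i} → + n ≡ i → + (p ℕ.* n) ≡ P ℤ.* i
      cast {n} eq = trans (ℤ.pos-* p n) (cong (P ℤ.*_) eq)

    Y≡ : Y ≡ + 9 ℤ.* (P ℤ.* (P ℤ.* + 1))
    Y≡ = trans (ℤ.pos-* 9 (p ℕ.^ 2)) (cong (+ 9 ℤ.*_) (trans (ℤ.pos-* p (p ℕ.* 1)) (cong (P ℤ.*_) (ℤ.pos-* p 1))))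

    ux≡ : ι u * x ≡ ι w
    ux≡ = ι-cancelˡ P³ {{P³≢0}} (begin
      ι P³ * (ι u * x)     ≡⟨ *-assoc (ι P³) (ι u) x ⟨
      ι P³ * ι u * x       ≡⟨ cong (_* x) (trans (sym (ι-* P³ u)) (cong ι (sym D≡))) ⟩
      ι D * x              ≡⟨ Dx≡t ⟩
      ι t                  ≡⟨ cong ι (trans t≡ (lemma P u k)) ⟩
      ι (P³ ℤ.* w)         ≡⟨ ι-* P³ w ⟩
      ι P³ * ι w           ∎)
      where
      P³ = P ℤ.* P ℤ.* P
      P³≢0 : ℤ.NonZero P³
      P³≢0 = ℤ.i*j≢0 (P ℤ.* P) P {{ℤ.i*j≢0 P P}}
      lemma : ∀ P u k → P ℤ.* P ℤ.* P ℤ.* P ℤ.* P ℤ.* (+ 9 ℤ.* u) ℤ.+ P ℤ.* P ℤ.* P ℤ.* P ℤ.* P ℤ.* (P ℤ.* P ℤ.* P) ℤ.* k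
        ≡ P ℤ.* P ℤ.* P ℤ.* (P ℤ.* P ℤ.* (+ 9 ℤ.* u) ℤ.+ P ℤ.* P ℤ.* P ℤ.* P ℤ.* P ℤ.* k)
      lemma = ℤ-Solver.solve-∀

    mz≡ : ι m * z ≡ x - y
    mz≡ = begin
      ι m * ((x - y) * (+ 1 / p ℕ.^ 5))   ≡⟨ solve 3 (λ m d e → m ⊕ (d ⊕ e) ⊜ d ⊕ (m ⊕ e)) refl (ι m) (x - y) (+ 1 / p ℕ.^ 5) ⟩
      (x - y) * (ι m * (+ 1 / p ℕ.^ 5))   ≡⟨ cong ((x - y) *_) (ι-*-/ (+ 1) (p ℕ.^ 5)) ⟩
      (x - y) * 1ℚ                        ≡⟨ *-identityʳ (x - y) ⟩
      x - y                               ∎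

    uz≡k : ι u * z ≡ ι k
    uz≡k = ι-cancelˡ m (begin
      ι m * (ι u * z)                ≡⟨ solve 3 (λ m u z → m ⊕ (u ⊕ z) ⊜ u ⊕ (m ⊕ z)) refl (ι m) (ι u) z ⟩
      ι u * (ι m * z)                ≡⟨ cong (ι u *_) mz≡ ⟩
      ι u * (x - y)                  ≡⟨ *-distribˡ-+ (ι u) x (- y) ⟩
      ι u * x + ι u * - y            ≡⟨ cong₂ (λ a b → a + ι u * b) ux≡ (sym (ι-neg Y)) ⟩
      ι w + ι u * ι (ℤ.- Y)          ≡⟨ cong (λ b → ι w + b) (ι-* u (ℤ.- Y)) ⟨
      ι w + ι (u ℤ.* ℤ.- Y)          ≡⟨ ι-+ w (u ℤ.* ℤ.- Y) ⟨
      ι (w ℤ.+ u ℤ.* ℤ.- Y)          ≡⟨ cong ι (trans (cong (λ Y → w ℤ.+ u ℤ.* ℤ.- Y) Y≡) (trans (lemma P u k) (cong (ℤ._* k) (sym m≡)))) ⟩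
      ι (m ℤ.* k)                    ≡⟨ ι-* m k ⟩
      ι m * ι k                      ∎)
      where
      lemma : ∀ P u k → P ℤ.* P ℤ.* (+ 9 ℤ.* u) ℤ.+ P ℤ.* P ℤ.* P ℤ.* P ℤ.* P ℤ.* k ℤ.+ u ℤ.* ℤ.- (+ 9 ℤ.* (P ℤ.* (P ℤ.* + 1)))
        ≡ P ℤ.* (P ℤ.* (P ℤ.* (P ℤ.* (P ℤ.* + 1)))) ℤ.* k
      lemma = ℤ-Solver.solve-∀

-- The prime 3 and the primes above it.

module Supercongruence where
  open import Defs
  open import Data.Integer using (+_; -_)
  open import Data.Nat using (_<_; _+_; _*_; _^_; z≤n; s≤s)
  open import Data.Nat.Divisibility using (divides; _∣?_)
  import Data.Nat.Properties as ℕ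
  open import Data.Nat.Primality using (prime⇒irreducible)
  open import Data.Product using (∃-syntax; _,_)
  open import Data.Rational using (ℚ)
  import Data.Rational as ℚ
  open import Data.Sum using (_⊎_; inj₁; inj₂)
  open import Relation.Binary.PropositionalEquality using (_≡_; refl; sym; trans; cong)
  open import Relation.Nullary using (contradiction)
  open import Relation.Nullary.Decidable using (toWitnessFalse)
  open Congruence using (modulo)
  open PrimeModulus using (≅0⇒∣)
  open WilfZeilberger using (T)
  open Evaluation using (denominator)
  open Summands using (summand; double)
  open RationalSums

  parity : ∀ n → ∃[ k ] (n ≡ k + k ⊎ n ≡ suc (k + k))
  parity zero    = 0 , inj₁ refl
  parity (suc n) with parity n
  ... | k , inj₁ refl = k , inj₂ refl
  ... | k , inj₂ refl = suc k , inj₁ (cong suc (sym (ℕ.+-suc k k)))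

  odd : ∀ p → Prime p → 2 < p → ∃[ k ] p ≡ suc (k + k)
  odd p p-prime 2<p with parity p
  ... | k , inj₂ eq = k , eq
  ... | k , inj₁ eq with prime⇒irreducible p-prime (divides k (trans eq (trans (sym (double k)) (ℕ.*-comm 2 k))))
  ...   | inj₂ 2≡p = contradiction 2≡p (ℕ.<⇒≢ 2<p)

  module _ (term : ℕ → ℚ) (cleared : ∀ n → ι (denominator n) ℚ.* term n ≡ ι (summand n)) where
    supercongruence-at-3 : Prime 3 → ∑< 3 term ≡ fromℕ (9 * 3 ^ 2) [mod 3 ^ 5 ]⟨ 3 ⟩
    -- The first constant `u` comes from `64² 2!³ 5!³ = 27 u`. The second is the quotient `k` in
    -- `T 3 1 = 3⁵ (9 u) + 3⁸ k`. Both equations hold by evaluation.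
    supercongruence-at-3 3-prime = congruence-from-cleared 3-prime (denominator 2) (+ 2097152000) (T 3 (+ 1)) (∑< 3 term)
      refl (modulo (- + 600234000) refl) (λ u≅0 → toWitnessFalse {a? = 3 ∣? 2097152000} _ (≅0⇒∣ u≅0)) (∑-cleared term cleared 2)

    supercongruence-above-3 : ∀ k (p-prime : Prime (suc (k + k))) → 3 < suc (k + k) →
      ∑< (suc (k + k)) term ≡ fromℕ (9 * suc (k + k) ^ 2) [mod suc (k + k) ^ 5 ]⟨ suc (k + k) ⟩
    supercongruence-above-3 k p-prime 3<p = congruence-from-cleared p-prime
      (denominator (k + k)) unit (T (suc (k + k)) (+ 1)) (∑< (suc (k + k)) term)
      denominator≡ T-at-one≅ unit≇0 (∑-cleared term cleared (k + k))
      where open AtPrime k p-prime 3<p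

    supercongruence : ∀ p → Prime p → 2 < p → ∑< p term ≡ fromℕ (9 * p ^ 2) [mod p ^ 5 ]⟨ p ⟩
    supercongruence p p-prime 2<p with odd p p-prime 2<p
    -- The cases `k = 0` and `k = 1` are `p = 1` and `p = 3`; from `k = 2` on, `p` exceeds 3.
    ... | zero             , refl = contradiction 2<p λ { (s≤s ()) }
    ... | suc zero         , refl = supercongruence-at-3 p-prime
    ... | k@(suc (suc k′)) , refl = supercongruence-above-3 k p-prime
      (s≤s (s≤s (s≤s (ℕ.≤-trans (s≤s z≤n) (ℕ.m≤n+m k k′)))))

-- The supercongruence for both forms of the sum.

open import Defs
open import Data.Nat using (ℕ; _<_; _*_; _^_)
open import Data.Nat.Primality using (Prime)
open import Data.Product using (_×_; _,_)
open RationalSums using (pochhammerTerm-cleared; binomialTerm-cleared)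
open Supercongruence using (supercongruence)

theorem1p2 : ∀ (p : ℕ) → Prime p → 2 < p →
    (∑< p pochhammerTerm ≡ fromℕ (9 * p ^ 2) [mod p ^ 5 ]⟨ p ⟩)
    × (∑< p binomialTerm ≡ fromℕ (9 * p ^ 2) [mod p ^ 5 ]⟨ p ⟩)
theorem1p2 p p-prime 2<p =
    supercongruence pochhammerTerm pochhammerTerm-cleared p p-prime 2<p
  , supercongruence binomialTerm binomialTerm-cleared p p-prime 2<p
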